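{- For every positive integer $n$, the number $S_n(1324)$ of permutations of length $n$ that avoid the pattern $1324$ satisfies \[ S_n(1324) < (7+4\sqrt{3})^n. \]
   Context: A permutation of length $n$ is written in one-line notation $p=p_1p_2\cdots p_n$. A permutation $p=p_1\cdots p_n$ avoids a pattern $q=q_1q_2\cdots q_k$ (a permutation of length $k$) if there are no $k$ indices $i_1<i_2<\cdots<i_k$ such that for all $a$ and $b$, $p_{i_a}<p_{i_b}$ holds if and only if $q_a<q_b$ holds. In particular $p$ avoids $1324$ if there are no indices $i_1<i_2<i_3<i_4$ with $p_{i_1}<p_{i_3}<p_{i_2}<p_{i_4}$. $S_n(1324)$ denotes the number of permutations of length $n$ avoiding $1324$. -}

module Defs where

open import Data.Nat as ℕ using (ℕ; zero; suc)
import Data.Nat.Properties as ℕ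
open import Data.Nat.Solver using (module +-*-Solver)
open import Data.Integer as ℤ using (+_; +[1+_])
import Data.Integer.Properties as ℤ
import Data.Integer.Solver as ℤ
open import Data.Rational as ℚ using (ℚ; mkℚ; 0ℚ; 1ℚ; ½; ∣_∣)
import Data.Rational.Properties as ℚ
open import Data.Rational.Unnormalised as ℚᵘ using (mkℚᵘ)
import Data.Rational.Unnormalised.Properties as ℚᵘ
import Data.Rational.Solver as ℚ
open import Data.Fin as Fin using (Fin; #_)
import Data.Fin.Properties as Fin
open import Data.List as List using (List; []; _∷_)
open import Data.Vec as Vec using (Vec; []; _∷_; lookup)
open import Data.Vec.Relation.Unary.AllPairs using (allPairs?)
open import Data.Vec.Relation.Unary.Unique.Propositional using (Unique)
open import Data.Product using (_×_; _,_; proj₁; proj₂; ∃; ∃-syntax; uncurry)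
open import Data.Sum using (inj₁; inj₂)
open import Function using (_⇔_; mk⇔; Equivalence; _∘_)
open import Relation.Nullary using (Dec; yes; no; ¬_; ¬?; _×-dec_; _→-dec_)
open import Relation.Nullary.Decidable using (map′)
open import Relation.Unary using (Decidable)
open import Relation.Binary.PropositionalEquality
  using (_≡_; refl; sym; trans; cong; cong₂; subst; subst₂)

-- One-line notation, with positions and values both numbered from 0.
IsPermutation : ∀ {n} → Vec (Fin n) n → Set
IsPermutation = Unique

record IsOccurrence {n k} (q : Vec (Fin k) k) (p : Vec (Fin n) n)
                    (i : Vec (Fin n) k) : Set where
  constructor occurrence
  field
    increasing : ∀ a b → a Fin.< b → lookup i a Fin.< lookup i b
    isomorphic : ∀ a b → lookup p (lookup i a) Fin.< lookup p (lookup i b)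
                         ⇔ lookup q a Fin.< lookup q b

Avoids : ∀ {n k} → Vec (Fin k) k → Vec (Fin n) n → Set
Avoids q p = ¬ ∃ (IsOccurrence q p)

[1324] : Vec (Fin 4) 4
[1324] = # 0 ∷ # 2 ∷ # 1 ∷ # 3 ∷ []

isPermutation? : ∀ {n} → Decidable (IsPermutation {n})
isPermutation? = allPairs? λ x y → ¬? (x Fin.≟ y)

_⇔-dec_ : ∀ {A B : Set} → Dec A → Dec B → Dec (A ⇔ B)
a? ⇔-dec b? = map′ (uncurry mk⇔) (λ e → Equivalence.to e , Equivalence.from e)
                   ((a? →-dec b?) ×-dec (b? →-dec a?))

anyVec? : ∀ {n} k {P : Vec (Fin n) k → Set} → Decidable P → Dec (∃ P)
anyVec? zero    P? = map′ ([] ,_) (λ { ([] , px) → px }) (P? [])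
anyVec? (suc k) P? =
  map′ (λ { (x , xs , px) → x ∷ xs , px }) (λ { (x ∷ xs , px) → x , xs , px })
       (Fin.any? λ x → anyVec? k λ xs → P? (x ∷ xs))

isOccurrence? : ∀ {n k} (q : Vec (Fin k) k) (p : Vec (Fin n) n) →
                Decidable (IsOccurrence q p)
isOccurrence? q p i = map′
  (uncurry occurrence)
  (λ o → IsOccurrence.increasing o , IsOccurrence.isomorphic o)
  ((Fin.all? λ a → Fin.all? λ b →
      (a Fin.<? b) →-dec (lookup i a Fin.<? lookup i b))
   ×-dec
   (Fin.all? λ a → Fin.all? λ b →
      (lookup p (lookup i a) Fin.<? lookup p (lookup i b))
      ⇔-dec (lookup q a Fin.<? lookup q b)))

avoids? : ∀ {n k} (q : Vec (Fin k) k) → Decidable (Avoids {n} q)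
avoids? q p = ¬? (anyVec? _ (isOccurrence? q p))

words : ∀ n k → List (Vec (Fin n) k)
words n zero    = [] ∷ []
words n (suc k) = List.cartesianProductWith _∷_ (List.allFin n) (words n k)

permutations : ∀ n → List (Vec (Fin n) n)
permutations n = List.filter isPermutation? (words n n)

S : ∀ {k} → ℕ → Vec (Fin k) k → ℕ
S n q = List.length (List.filter (avoids? q) (permutations n))

≤-by-cross : ∀ a j b k → a ℕ.* suc k ℕ.≤ b ℕ.* suc j →
             + a ℚ./ suc j ℚ.≤ + b ℚ./ suc k
≤-by-cross a j b k h = ℚ.toℚᵘ-cancel-≤
  (ℚᵘ.≤-respˡ-≃ (ℚᵘ.≃-sym (ℚ.toℚᵘ-fromℚᵘ (mkℚᵘ (+ a) j)))
  (ℚᵘ.≤-respʳ-≃ (ℚᵘ.≃-sym (ℚ.toℚᵘ-fromℚᵘ (mkℚᵘ (+ b) k)))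
  (ℚᵘ.*≤* (subst₂ ℤ._≤_ (ℤ.pos-* a (suc k)) (ℤ.pos-* b (suc j)) (ℤ.+≤+ h)))))

suc-/ : ∀ a k → + suc a ℚ./ suc k ≡ + a ℚ./ suc k ℚ.+ + 1 ℚ./ suc k
suc-/ a k = ℚ.toℚᵘ-injective (ℚᵘ.≃-trans (ℚ.toℚᵘ-fromℚᵘ (mkℚᵘ (+ suc a) k))
  (ℚᵘ.≃-sym (ℚᵘ.≃-trans (ℚ.toℚᵘ-homo-+ (+ a ℚ./ suc k) (+ 1 ℚ./ suc k))
  (ℚᵘ.≃-trans (ℚᵘ.+-cong (ℚ.toℚᵘ-fromℚᵘ (mkℚᵘ (+ a) k)) (ℚ.toℚᵘ-fromℚᵘ (mkℚᵘ (+ 1) k)))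
  (ℚᵘ.*≡* (eq (+ a) (+ suc k)))))))
  where
  eq : ∀ a k → (a ℤ.* k ℤ.+ + 1 ℤ.* k) ℤ.* k ≡ (+ 1 ℤ.+ a) ℤ.* (k ℤ.* k)
  eq = solve 2 (λ a k → (a :* k :+ con (+ 1) :* k) :* k := (con (+ 1) :+ a) :* (k :* k)) refl
    where open ℤ.+-*-Solver

archimedean : ∀ ε → 0ℚ ℚ.< ε → ∃[ N ] ∀ k → N ℕ.≤ k → + 1 ℚ./ suc k ℚ.≤ ε
archimedean ε 0<ε with ℚ.positive 0<ε
archimedean ε@(mkℚ +[1+ a ] d c) 0<ε | _ = d , λ k d≤k →
  subst (+ 1 ℚ./ suc k ℚ.≤_) (ℚ.↥p/↧p≡p ε) (≤-by-cross 1 k (suc a) d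
    (ℕ.*-mono-≤ (ℕ.s≤s (ℕ.z≤n {a})) (ℕ.s≤s d≤k)))

0<p*q : ∀ {p q} → 0ℚ ℚ.< p → 0ℚ ℚ.< q → 0ℚ ℚ.< p ℚ.* q
0<p*q {p} {q} 0<p 0<q = ℚ.positive⁻¹ (p ℚ.* q)
  {{ℚ.pos*pos⇒pos p {{ℚ.positive 0<p}} q {{ℚ.positive 0<q}}}}

*-mono-≤₀ : ∀ {p q r s} → 0ℚ ℚ.≤ p → 0ℚ ℚ.≤ s → p ℚ.≤ q → r ℚ.≤ s →
            p ℚ.* r ℚ.≤ q ℚ.* s
*-mono-≤₀ {p} {q} {r} {s} 0≤p 0≤s p≤q r≤s = ℚ.≤-trans
  (ℚ.*-monoˡ-≤-nonNeg p {{ℚ.nonNegative 0≤p}} r≤s)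
  (ℚ.*-monoʳ-≤-nonNeg s {{ℚ.nonNegative 0≤s}} p≤q)

p-q≤ : ∀ {p q r} → p ℚ.≤ q ℚ.+ r → p ℚ.- q ℚ.≤ r
p-q≤ {p} {q} {r} h = subst (p ℚ.- q ℚ.≤_) (eq q r) (ℚ.+-monoˡ-≤ (ℚ.- q) h)
  where
  eq : ∀ q r → (q ℚ.+ r) ℚ.- q ≡ r
  eq = solve 2 (λ q r → (q :+ r) :- q := r) refl where open ℚ.+-*-Solver

∣p-q∣≤ : ∀ {p q r} → p ℚ.≤ q ℚ.+ r → q ℚ.≤ p ℚ.+ r → ∣ p ℚ.- q ∣ ℚ.≤ r
∣p-q∣≤ {p} {q} {r} h₁ h₂ with ℚ.∣p∣≡p∨∣p∣≡-p (p ℚ.- q)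
... | inj₁ e = subst (ℚ._≤ r) (sym e) (p-q≤ h₁)
... | inj₂ e = subst (ℚ._≤ r) (sym (trans e (eq p q))) (p-q≤ h₂)
  where
  eq : ∀ p q → ℚ.- (p ℚ.- q) ≡ q ℚ.- p
  eq = solve 2 (λ p q → :- (p :- q) := q :- p) refl where open ℚ.+-*-Solver

-- Real numbers are Cauchy sequences of rationals, identified by _≃ℝ_.
IsCauchy : (ℕ → ℚ) → Set
IsCauchy x = ∀ ε → 0ℚ ℚ.< ε →
  ∃[ N ] ∀ m n → N ℕ.≤ m → N ℕ.≤ n → ∣ x m ℚ.- x n ∣ ℚ.≤ ε

record ℝ : Set where
  constructor mkℝ
  field
    seq      : ℕ → ℚ
    isCauchy : IsCauchy seq

open ℝ public

infix  4 _≃ℝ_ _<ℝ_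
infixl 6 _+ℝ_
infixl 7 _*ℝ_
infixr 8 _^ℝ_
infix  9 √_

_≃ℝ_ : ℝ → ℝ → Set
x ≃ℝ y = ∀ ε → 0ℚ ℚ.< ε → ∃[ N ] ∀ n → N ℕ.≤ n → ∣ seq x n ℚ.- seq y n ∣ ℚ.≤ ε

-- The gap ε must be uniform in n: an eventual termwise < only yields ≤ in the limit.
_<ℝ_ : ℝ → ℝ → Set
x <ℝ y = ∃[ ε ] 0ℚ ℚ.< ε × ∃[ N ] ∀ n → N ℕ.≤ n → seq x n ℚ.+ ε ℚ.≤ seq y n

fromℕ : ℕ → ℝ
fromℕ m = mkℝ (λ _ → + m ℚ./ 1) λ ε 0<ε → 0 , λ _ _ _ _ →
  subst (λ d → ∣ d ∣ ℚ.≤ ε) (sym (ℚ.+-inverseʳ (+ m ℚ./ 1))) (ℚ.<⇒≤ 0<ε)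

+-isCauchy : ∀ {x y} → IsCauchy x → IsCauchy y → IsCauchy (λ n → x n ℚ.+ y n)
+-isCauchy {x} {y} cx cy ε 0<ε = Nx ℕ.⊔ Ny , λ m n N≤m N≤n → begin
  ∣ (x m ℚ.+ y m) ℚ.- (x n ℚ.+ y n) ∣     ≡⟨ cong ∣_∣ (eq (x m) (y m) (x n) (y n)) ⟩
  ∣ (x m ℚ.- x n) ℚ.+ (y m ℚ.- y n) ∣     ≤⟨ ℚ.∣p+q∣≤∣p∣+∣q∣ (x m ℚ.- x n) (y m ℚ.- y n) ⟩
  ∣ x m ℚ.- x n ∣ ℚ.+ ∣ y m ℚ.- y n ∣     ≤⟨ ℚ.+-mono-≤
    (hx m n (ℕ.m⊔n≤o⇒m≤o Nx Ny N≤m) (ℕ.m⊔n≤o⇒m≤o Nx Ny N≤n))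
    (hy m n (ℕ.m⊔n≤o⇒n≤o Nx Ny N≤m) (ℕ.m⊔n≤o⇒n≤o Nx Ny N≤n)) ⟩
  ½ ℚ.* ε ℚ.+ ½ ℚ.* ε                     ≡⟨ half ε ⟩
  ε                                       ∎
  where
  open ℚ.≤-Reasoning
  0<½ε = 0<p*q (ℚ.positive⁻¹ ½) 0<ε
  Nx = proj₁ (cx (½ ℚ.* ε) 0<½ε)
  hx = proj₂ (cx (½ ℚ.* ε) 0<½ε)
  Ny = proj₁ (cy (½ ℚ.* ε) 0<½ε)
  hy = proj₂ (cy (½ ℚ.* ε) 0<½ε)
  half : ∀ ε → ½ ℚ.* ε ℚ.+ ½ ℚ.* ε ≡ ε
  half ε = trans (sym (ℚ.*-distribʳ-+ ε ½ ½)) (ℚ.*-identityˡ ε)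
  eq : ∀ a b c d → (a ℚ.+ b) ℚ.- (c ℚ.+ d) ≡ (a ℚ.- c) ℚ.+ (b ℚ.- d)
  eq = solve 4 (λ a b c d → (a :+ b) :- (c :+ d) := (a :- c) :+ (b :- d)) refl
    where open ℚ.+-*-Solver

bounded : ∀ {x} → IsCauchy x → ∃[ B ] 0ℚ ℚ.< B × ∃[ N ] ∀ n → N ℕ.≤ n → ∣ x n ∣ ℚ.≤ B
bounded {x} cx = ∣ x N ∣ ℚ.+ 1ℚ
  , ℚ.+-mono-≤-< (ℚ.0≤∣p∣ (x N)) (ℚ.positive⁻¹ 1ℚ)
  , N , λ n N≤n → begin
  ∣ x n ∣                           ≡⟨ cong ∣_∣ (eq (x n) (x N)) ⟩
  ∣ x N ℚ.+ (x n ℚ.- x N) ∣         ≤⟨ ℚ.∣p+q∣≤∣p∣+∣q∣ (x N) (x n ℚ.- x N) ⟩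
  ∣ x N ∣ ℚ.+ ∣ x n ℚ.- x N ∣       ≤⟨ ℚ.+-monoʳ-≤ ∣ x N ∣ (proj₂ c n N N≤n ℕ.≤-refl) ⟩
  ∣ x N ∣ ℚ.+ 1ℚ                    ∎
  where
  open ℚ.≤-Reasoning
  c = cx 1ℚ (ℚ.positive⁻¹ 1ℚ)
  N = proj₁ c
  eq : ∀ a b → a ≡ b ℚ.+ (a ℚ.- b)
  eq = solve 2 (λ a b → a := b :+ (a :- b)) refl where open ℚ.+-*-Solver

divide : ∀ {ε} B → 0ℚ ℚ.< B → 0ℚ ℚ.< ε → ∃[ δ ] 0ℚ ℚ.< δ × B ℚ.* δ ≡ ε
divide {ε} B 0<B 0<ε = 1/B ℚ.* ε
  , 0<p*q (ℚ.positive⁻¹ 1/B {{ℚ.1/pos⇒pos B}}) 0<ε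
  , trans (sym (ℚ.*-assoc B 1/B ε)) (trans (cong (ℚ._* ε) (ℚ.*-inverseʳ B)) (ℚ.*-identityˡ ε))
  where
  instance
    B-pos = ℚ.positive 0<B
    B-nonZero = ℚ.pos⇒nonZero B
  1/B = ℚ.1/ B

product-close : ∀ a b c d {A B δ} → 0ℚ ℚ.≤ δ → ∣ a ∣ ℚ.≤ A → ∣ d ∣ ℚ.≤ B →
                ∣ a ℚ.- c ∣ ℚ.≤ δ → ∣ b ℚ.- d ∣ ℚ.≤ δ →
                ∣ a ℚ.* b ℚ.- c ℚ.* d ∣ ℚ.≤ (A ℚ.+ B) ℚ.* δ
product-close a b c d {A} {B} {δ} 0≤δ a≤A d≤B ac bd = begin
  ∣ a ℚ.* b ℚ.- c ℚ.* d ∣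
    ≡⟨ cong ∣_∣ (eq a b c d) ⟩
  ∣ a ℚ.* (b ℚ.- d) ℚ.+ d ℚ.* (a ℚ.- c) ∣
    ≤⟨ ℚ.∣p+q∣≤∣p∣+∣q∣ (a ℚ.* (b ℚ.- d)) (d ℚ.* (a ℚ.- c)) ⟩
  ∣ a ℚ.* (b ℚ.- d) ∣ ℚ.+ ∣ d ℚ.* (a ℚ.- c) ∣
    ≡⟨ cong₂ ℚ._+_ (ℚ.∣p*q∣≡∣p∣*∣q∣ a (b ℚ.- d)) (ℚ.∣p*q∣≡∣p∣*∣q∣ d (a ℚ.- c)) ⟩
  ∣ a ∣ ℚ.* ∣ b ℚ.- d ∣ ℚ.+ ∣ d ∣ ℚ.* ∣ a ℚ.- c ∣
    ≤⟨ ℚ.+-mono-≤ (*-mono-≤₀ (ℚ.0≤∣p∣ a) 0≤δ a≤A bd) (*-mono-≤₀ (ℚ.0≤∣p∣ d) 0≤δ d≤B ac) ⟩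
  A ℚ.* δ ℚ.+ B ℚ.* δ
    ≡⟨ ℚ.*-distribʳ-+ δ A B ⟨
  (A ℚ.+ B) ℚ.* δ ∎
  where
  open ℚ.≤-Reasoning
  eq : ∀ a b c d → a ℚ.* b ℚ.- c ℚ.* d ≡ a ℚ.* (b ℚ.- d) ℚ.+ d ℚ.* (a ℚ.- c)
  eq a b c d = trans
    (cong (ℚ._- c ℚ.* d) (split a b d))
    (trans (ℚ.+-assoc (a ℚ.* (b ℚ.- d)) (a ℚ.* d) (ℚ.- (c ℚ.* d)))
           (cong (a ℚ.* (b ℚ.- d) ℚ.+_) (factor a c d)))
    where
    split : ∀ a b d → a ℚ.* b ≡ a ℚ.* (b ℚ.- d) ℚ.+ a ℚ.* d
    split = solve 3 (λ a b d → a :* b := a :* (b :- d) :+ a :* d) refl where open ℚ.+-*-Solver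
    factor : ∀ a c d → a ℚ.* d ℚ.- c ℚ.* d ≡ d ℚ.* (a ℚ.- c)
    factor = solve 3 (λ a c d → a :* d :- c :* d := d :* (a :- c)) refl where open ℚ.+-*-Solver

*-isCauchy : ∀ {x y} → IsCauchy x → IsCauchy y → IsCauchy (λ n → x n ℚ.* y n)
*-isCauchy {x} {y} cx cy ε 0<ε =
  let Bx , 0<Bx , Mx , bx = bounded cx
      By , 0<By , My , by = bounded cy
      δ , 0<δ , eδ = divide (Bx ℚ.+ By) (ℚ.+-mono-< 0<Bx 0<By) 0<ε
      Nx , hx = cx δ 0<δ
      Ny , hy = cy δ 0<δ
      N = (Mx ℕ.⊔ My) ℕ.⊔ (Nx ℕ.⊔ Ny)
      M≤ : ∀ {k} → N ℕ.≤ k → Mx ℕ.⊔ My ℕ.≤ k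
      M≤ = ℕ.m⊔n≤o⇒m≤o (Mx ℕ.⊔ My) (Nx ℕ.⊔ Ny)
      N≤ : ∀ {k} → N ℕ.≤ k → Nx ℕ.⊔ Ny ℕ.≤ k
      N≤ = ℕ.m⊔n≤o⇒n≤o (Mx ℕ.⊔ My) (Nx ℕ.⊔ Ny)
  in N , λ m n ≤m ≤n →
     subst (∣ x m ℚ.* y m ℚ.- x n ℚ.* y n ∣ ℚ.≤_) eδ
       (product-close (x m) (y m) (x n) (y n) (ℚ.<⇒≤ 0<δ)
         (bx m (ℕ.m⊔n≤o⇒m≤o Mx My (M≤ ≤m)))
         (by n (ℕ.m⊔n≤o⇒n≤o Mx My (M≤ ≤n)))
         (hx m n (ℕ.m⊔n≤o⇒m≤o Nx Ny (N≤ ≤m)) (ℕ.m⊔n≤o⇒m≤o Nx Ny (N≤ ≤n)))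
         (hy m n (ℕ.m⊔n≤o⇒n≤o Nx Ny (N≤ ≤m)) (ℕ.m⊔n≤o⇒n≤o Nx Ny (N≤ ≤n))))

_+ℝ_ : ℝ → ℝ → ℝ
x +ℝ y = mkℝ (λ n → seq x n ℚ.+ seq y n) (+-isCauchy {seq x} {seq y} (isCauchy x) (isCauchy y))

_*ℝ_ : ℝ → ℝ → ℝ
x *ℝ y = mkℝ (λ n → seq x n ℚ.* seq y n) (*-isCauchy {seq x} {seq y} (isCauchy x) (isCauchy y))

_^ℝ_ : ℝ → ℕ → ℝ
x ^ℝ zero  = fromℕ 1
x ^ℝ suc n = x *ℝ x ^ℝ n

-- ⌊√ m ⌋ is the integer part of the square root of m; √-step m computes
-- it from that of m - 1, taken as an argument so that evaluation shares it.
√-step : ℕ → ℕ → ℕ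
√-step m r with suc r ℕ.* suc r ℕ.≤? m
... | yes _ = suc r
... | no  _ = r

⌊√_⌋ : ℕ → ℕ
⌊√ zero ⌋  = zero
⌊√ suc m ⌋ = √-step (suc m) ⌊√ m ⌋

√-step-lower : ∀ m r → r ℕ.* r ℕ.≤ m → √-step (suc m) r ℕ.* √-step (suc m) r ℕ.≤ suc m
√-step-lower m r h with suc r ℕ.* suc r ℕ.≤? suc m
... | yes h′ = h′
... | no  _  = ℕ.m≤n⇒m≤1+n h

√-step-upper : ∀ m r → m ℕ.< suc r ℕ.* suc r →
               suc m ℕ.< suc (√-step (suc m) r) ℕ.* suc (√-step (suc m) r)
√-step-upper m r h with suc r ℕ.* suc r ℕ.≤? suc m
... | yes _  = ℕ.≤-<-trans h (ℕ.*-mono-< (ℕ.n<1+n (suc r)) (ℕ.n<1+n (suc r)))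
... | no  h′ = ℕ.≰⇒> h′

⌊√⌋-lower : ∀ m → ⌊√ m ⌋ ℕ.* ⌊√ m ⌋ ℕ.≤ m
⌊√⌋-lower zero    = ℕ.z≤n
⌊√⌋-lower (suc m) = √-step-lower m ⌊√ m ⌋ (⌊√⌋-lower m)

⌊√⌋-upper : ∀ m → m ℕ.< suc ⌊√ m ⌋ ℕ.* suc ⌊√ m ⌋
⌊√⌋-upper zero    = ℕ.s≤s ℕ.z≤n
⌊√⌋-upper (suc m) = √-step-upper m ⌊√ m ⌋ (⌊√⌋-upper m)

-- √m is approximated from below by ⌊√(m(k+1)²)⌋ / (k+1).
√-numerator : ℕ → ℕ → ℕ
√-numerator m k = ⌊√ m ℕ.* (suc k ℕ.* suc k) ⌋

√-seq : ℕ → ℕ → ℚ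
√-seq m k = + √-numerator m k ℚ./ suc k

*-self-cancel-≤ : ∀ a b → a ℕ.* a ℕ.≤ b ℕ.* b → a ℕ.≤ b
*-self-cancel-≤ a b h = ℕ.≮⇒≥ λ b<a → ℕ.<⇒≱ (ℕ.*-mono-< b<a b<a) h

√-seq-close : ∀ m j k → √-seq m j ℚ.≤ √-seq m k ℚ.+ + 1 ℚ./ suc k
√-seq-close m j k = subst (√-seq m j ℚ.≤_) (suc-/ (√-numerator m k) k)
  (≤-by-cross r j (suc s) k (*-self-cancel-≤ _ _ (begin
    (r ℕ.* K) ℕ.* (r ℕ.* K)             ≡⟨ interchange r K ⟩
    (r ℕ.* r) ℕ.* (K ℕ.* K)             ≤⟨ ℕ.*-monoˡ-≤ (K ℕ.* K) (⌊√⌋-lower (m ℕ.* (J ℕ.* J))) ⟩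
    (m ℕ.* (J ℕ.* J)) ℕ.* (K ℕ.* K)     ≡⟨ swap m J K ⟩
    (m ℕ.* (K ℕ.* K)) ℕ.* (J ℕ.* J)     ≤⟨ ℕ.*-monoˡ-≤ (J ℕ.* J) (ℕ.<⇒≤ (⌊√⌋-upper (m ℕ.* (K ℕ.* K)))) ⟩
    (suc s ℕ.* suc s) ℕ.* (J ℕ.* J)     ≡⟨ interchange (suc s) J ⟨
    (suc s ℕ.* J) ℕ.* (suc s ℕ.* J)     ∎)))
  where
  open ℕ.≤-Reasoning
  J = suc j
  K = suc k
  r = √-numerator m j
  s = √-numerator m k
  open +-*-Solver
  interchange : ∀ a b → (a ℕ.* b) ℕ.* (a ℕ.* b) ≡ (a ℕ.* a) ℕ.* (b ℕ.* b)
  interchange = solve 2 (λ a b → (a :* b) :* (a :* b) := (a :* a) :* (b :* b)) refl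
  swap : ∀ m a b → (m ℕ.* (a ℕ.* a)) ℕ.* (b ℕ.* b) ≡ (m ℕ.* (b ℕ.* b)) ℕ.* (a ℕ.* a)
  swap = solve 3 (λ m a b → (m :* (a :* a)) :* (b :* b) := (m :* (b :* b)) :* (a :* a)) refl

√-isCauchy : ∀ m → IsCauchy (√-seq m)
√-isCauchy m ε 0<ε with archimedean ε 0<ε
... | N , h = N , λ j k N≤j N≤k → ∣p-q∣≤
  (ℚ.≤-trans (√-seq-close m j k) (ℚ.+-monoʳ-≤ (√-seq m k) (h k N≤k)))
  (ℚ.≤-trans (√-seq-close m k j) (ℚ.+-monoʳ-≤ (√-seq m j) (h j N≤j)))

√_ : ℕ → ℝ
√ m = mkℝ (√-seq m) (√-isCauchy m)

√-nonNegative : ∀ m k → 0ℚ ℚ.≤ √-seq m k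
√-nonNegative m k = ≤-by-cross 0 0 (√-numerator m k) k ℕ.z≤n

/-square : ∀ a k → (+ a ℚ./ suc k) ℚ.* (+ a ℚ./ suc k) ≡ + (a ℕ.* a) ℚ./ (suc k ℕ.* suc k)
/-square a k = ℚ.toℚᵘ-injective (ℚᵘ.≃-trans (ℚ.toℚᵘ-homo-* (+ a ℚ./ suc k) (+ a ℚ./ suc k))
  (ℚᵘ.≃-trans (ℚᵘ.*-cong (ℚ.toℚᵘ-fromℚᵘ (mkℚᵘ (+ a) k)) (ℚ.toℚᵘ-fromℚᵘ (mkℚᵘ (+ a) k)))
  (ℚᵘ.≃-trans (ℚᵘ.*≡* (cong (ℤ._* (+ (suc k ℕ.* suc k))) (sym (ℤ.pos-* a a))))
  (ℚᵘ.≃-sym (ℚ.toℚᵘ-fromℚᵘ (mkℚᵘ (+ (a ℕ.* a)) (k ℕ.+ k ℕ.* suc k)))))))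

√-seq² : ∀ m k → √-seq m k ℚ.* √-seq m k ℚ.≤ + m ℚ./ 1
√-seq² m k = subst (ℚ._≤ + m ℚ./ 1) (sym (/-square r k))
  (≤-by-cross (r ℕ.* r) (k ℕ.+ k ℕ.* suc k) m 0
    (subst (ℕ._≤ m ℕ.* (suc k ℕ.* suc k)) (sym (ℕ.*-identityʳ (r ℕ.* r)))
      (⌊√⌋-lower (m ℕ.* (suc k ℕ.* suc k)))))
  where r = √-numerator m k

√-seq≤ : ∀ m k → √-seq m k ℚ.≤ + m ℚ./ 1
√-seq≤ m k = ≤-by-cross r k m 0 (subst (ℕ._≤ m ℕ.* suc k) (sym (ℕ.*-identityʳ r))
  (*-self-cancel-≤ r (m ℕ.* suc k) (ℕ.≤-trans (⌊√⌋-lower (m ℕ.* (suc k ℕ.* suc k)))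
    (subst (m ℕ.* (suc k ℕ.* suc k) ℕ.≤_) (interchange m (suc k))
      (ℕ.*-monoˡ-≤ (suc k ℕ.* suc k) (m≤m*m m))))))
  where
  r = √-numerator m k
  m≤m*m : ∀ m → m ℕ.≤ m ℕ.* m
  m≤m*m zero    = ℕ.z≤n
  m≤m*m (suc m) = ℕ.m≤m*n (suc m) (suc m)
  interchange : ∀ a b → (a ℕ.* a) ℕ.* (b ℕ.* b) ≡ (a ℕ.* b) ℕ.* (a ℕ.* b)
  interchange = solve 2 (λ a b → (a :* a) :* (b :* b) := (a :* b) :* (a :* b)) refl
    where open +-*-Solver

≤[√-seq+]² : ∀ m k → + m ℚ./ 1 ℚ.≤
  (√-seq m k ℚ.+ + 1 ℚ./ suc k) ℚ.* (√-seq m k ℚ.+ + 1 ℚ./ suc k)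
≤[√-seq+]² m k = subst (λ t → + m ℚ./ 1 ℚ.≤ t ℚ.* t) (suc-/ r k)
  (subst (+ m ℚ./ 1 ℚ.≤_) (sym (/-square (suc r) k))
    (≤-by-cross m 0 (suc r ℕ.* suc r) (k ℕ.+ k ℕ.* suc k)
      (subst (m ℕ.* (suc k ℕ.* suc k) ℕ.≤_) (sym (ℕ.*-identityʳ (suc r ℕ.* suc r)))
        (ℕ.<⇒≤ (⌊√⌋-upper (m ℕ.* (suc k ℕ.* suc k)))))))
  where r = √-numerator m k

square-close : ∀ s d {M δ ε} → 0ℚ ℚ.≤ s → 0ℚ ℚ.≤ d → 0ℚ ℚ.≤ ε → 0ℚ ℚ.≤ δ →
               s ℚ.≤ M → d ℚ.≤ 1ℚ → d ℚ.≤ δ → ((M ℚ.+ M) ℚ.+ 1ℚ) ℚ.* δ ≡ ε →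
               s ℚ.* s ℚ.≤ M → M ℚ.≤ (s ℚ.+ d) ℚ.* (s ℚ.+ d) →
               ∣ s ℚ.* s ℚ.- M ∣ ℚ.≤ ε
square-close s d {M} {δ} {ε} 0≤s 0≤d 0≤ε 0≤δ s≤M d≤1 d≤δ eδ lo hi = ∣p-q∣≤
  (ℚ.≤-trans lo (subst (ℚ._≤ M ℚ.+ ε) (ℚ.+-identityʳ M) (ℚ.+-monoʳ-≤ M 0≤ε)))
  (begin
    M                                         ≤⟨ hi ⟩
    (s ℚ.+ d) ℚ.* (s ℚ.+ d)                   ≡⟨ expand s d ⟩
    s ℚ.* s ℚ.+ ((s ℚ.+ s) ℚ.+ d) ℚ.* d       ≤⟨ ℚ.+-monoʳ-≤ (s ℚ.* s)
      (*-mono-≤₀ (ℚ.+-mono-≤ (ℚ.+-mono-≤ 0≤s 0≤s) 0≤d) 0≤δ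
                 (ℚ.+-mono-≤ (ℚ.+-mono-≤ s≤M s≤M) d≤1) d≤δ) ⟩
    s ℚ.* s ℚ.+ ((M ℚ.+ M) ℚ.+ 1ℚ) ℚ.* δ      ≡⟨ cong (s ℚ.* s ℚ.+_) eδ ⟩
    s ℚ.* s ℚ.+ ε                             ∎)
  where
  open ℚ.≤-Reasoning
  expand : ∀ s d → (s ℚ.+ d) ℚ.* (s ℚ.+ d) ≡ s ℚ.* s ℚ.+ ((s ℚ.+ s) ℚ.+ d) ℚ.* d
  expand = solve 2 (λ s d → (s :+ d) :* (s :+ d) := s :* s :+ ((s :+ s) :+ d) :* d) refl
    where open ℚ.+-*-Solver

√-square : ∀ m → √ m *ℝ √ m ≃ℝ fromℕ m
√-square m ε 0<ε =
  let M = + m ℚ./ 1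
      0≤M : 0ℚ ℚ.≤ M
      0≤M = ≤-by-cross 0 0 m 0 ℕ.z≤n
      0≤1/ : ∀ k → 0ℚ ℚ.≤ + 1 ℚ./ suc k
      0≤1/ k = ≤-by-cross 0 0 1 k ℕ.z≤n
      1/≤1 : ∀ k → + 1 ℚ./ suc k ℚ.≤ 1ℚ
      1/≤1 k = ≤-by-cross 1 k 1 0 (ℕ.*-monoʳ-≤ 1 (ℕ.s≤s (ℕ.z≤n {k})))
      δ , 0<δ , eδ = divide ((M ℚ.+ M) ℚ.+ 1ℚ)
        (ℚ.+-mono-≤-< (ℚ.+-mono-≤ 0≤M 0≤M) (ℚ.positive⁻¹ 1ℚ)) 0<ε
      N , h = archimedean δ 0<δ
  in N , λ k N≤k → square-close (√-seq m k) (+ 1 ℚ./ suc k)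
       (√-nonNegative m k) (0≤1/ k) (ℚ.<⇒≤ 0<ε) (ℚ.<⇒≤ 0<δ)
       (√-seq≤ m k) (1/≤1 k) (h k N≤k) eδ (√-seq² m k) (≤[√-seq+]² m k)

{-# OPTIONS --safe #-}

-- Colour the entries of an avoider from left to right: an entry is blue if it exceeds an
-- earlier blue entry or completes a 132 whose middle entry is red, and red otherwise. Then
-- the red entries avoid 132, the blue ones avoid 213, and a red entry is smaller than every
-- blue one before it. Call a red entry outer if it is a left-to-right minimum, a blue one
-- if it is a right-to-left maximum, and all others inner. The two words that list the
-- resulting four labels by position and by value determine the permutation. A blue inner
-- entry just before (or one below) a red inner one would be the "32" of a 1324, so neither
-- word contains this factor; nor can it start with the letter red inner. There are
-- xₙ + yₙ such words, where (2 + √3)ⁿ = xₙ + yₙ√3, and (xₙ + yₙ)² < (xₙ + yₙ√3)² = (7 + 4√3)ⁿ.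

module Submission where

open import Defs
open import Data.Nat using (ℕ; NonZero)
open import Data.Nat as ℕ using (zero; suc)
import Data.Nat.Properties as ℕ
open import Data.Nat.ListAction using (sum)
open import Data.Nat.Solver using (module +-*-Solver)
open import Data.Integer using (+_)
open import Data.Rational as ℚ using (ℚ; 0ℚ; 1ℚ; ∣_∣)
import Data.Rational.Properties as ℚ
import Data.Rational.Solver as ℚ
open import Data.Fin as Fin using (Fin; zero; suc; toℕ; _<_; _≤_; _>_)
import Data.Fin.Properties as Fin
open import Data.Fin.Induction using (<-wellFounded; >-wellFounded)
open import Data.List as List using (List; []; _∷_; length; concatMap)
import Data.List.Properties as List
open import Data.List.Membership.Propositional using (_∈_)
open import Data.List.Membership.Propositional.Properties
  using (∈-lookup; ∈-map⁺; ∈-concatMap⁺; ∈-filter⁻; ∈-cartesianProduct⁺)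
import Data.List.Relation.Unary.All as All
open import Data.List.Relation.Unary.Any as Any using (here; there)
open import Data.List.Relation.Unary.Any.Properties using (lookup-index)
import Data.List.Relation.Unary.AllPairs as AllPairs
open import Data.List.Relation.Unary.Unique.Propositional using () renaming (Unique to Uniqueᴸ)
import Data.List.Relation.Unary.Unique.Propositional.Properties as Uniqueᴸ
open import Data.Vec as Vec using (Vec; []; _∷_; lookup; tabulate)
import Data.Vec.Properties as Vec
open import Data.Vec.Relation.Unary.Linked using ([-]; _∷_)
import Data.Vec.Relation.Unary.Linked.Properties as Linked
import Data.Vec.Relation.Unary.Unique.Propositional.Properties as Uniqueⱽ
open import Data.Product using (_×_; _,_; proj₁; proj₂; ∃; ∃₂; map₂)
open import Data.Sum using (_⊎_; inj₁; inj₂)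
open import Data.Empty using (⊥)
open import Function using (_∘_; mk⇔)
open import Function.Definitions using (Injective)
open import Induction.WellFounded using (WellFounded; Acc; acc)
open import Level using (0ℓ)
open import Relation.Binary using (Rel; Trichotomous; Tri; tri<; tri≈; tri>)
open import Relation.Binary.PropositionalEquality
open import Relation.Nullary using (Dec; yes; no; ¬_; contradiction; _×-dec_; _⊎-dec_)

-- Letters, and avoidance of 1324 in terms of positions and values

data Colour : Set where
  red blue : Colour

data Kind : Set where
  outer inner : Kind

Letter : Set
Letter = Colour × Kind

_≟ᶜ_ : (c d : Colour) → Dec (c ≡ d)
red  ≟ᶜ red  = yes refl
red  ≟ᶜ blue = no λ ()
blue ≟ᶜ red  = no λ ()
blue ≟ᶜ blue = yes refl

Avoids1324 : ∀ {n} → (Fin n → Fin n) → Set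
Avoids1324 f = ∀ {a b c d} → a < b → b < c → c < d →
  f a < f c → f c < f b → f b < f d → ⊥

module _ {n : ℕ} (p : Vec (Fin n) n) where

  avoids⇒avoids1324 : Avoids [1324] p → Avoids1324 (lookup p)
  avoids⇒avoids1324 avoids {a} {b} {c} {d} a<b b<c c<d fa<fc fc<fb fb<fd =
    avoids (indices , occurrence (λ _ _ → increasing) λ x y → mk⇔ (to x y) (from x y))
    where
    indices : Vec (Fin n) 4
    indices = a ∷ b ∷ c ∷ d ∷ []
    -- The four values in increasing order: the pattern letter at `x` is then the rank of the value
    -- at `x`, so it serves as an index into this list.
    values : Vec (Fin n) 4
    values = lookup p a ∷ lookup p c ∷ lookup p b ∷ lookup p d ∷ []
    increasing : ∀ {x y} → x < y → lookup indices x < lookup indices y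
    increasing = Linked.lookup⁺ {R = _<_} Fin.<-trans (a<b ∷ b<c ∷ c<d ∷ [-])
    value : ∀ x → lookup p (lookup indices x) ≡ lookup values (lookup [1324] x)
    value zero                   = refl
    value (suc zero)             = refl
    value (suc (suc zero))       = refl
    value (suc (suc (suc zero))) = refl
    value-mono : ∀ {x y} → x < y → lookup values x < lookup values y
    value-mono = Linked.lookup⁺ {R = _<_} Fin.<-trans (fa<fc ∷ fc<fb ∷ fb<fd ∷ [-])
    from : ∀ x y → lookup [1324] x < lookup [1324] y →
           lookup p (lookup indices x) < lookup p (lookup indices y)
    from x y qx<qy = subst₂ _<_ (sym (value x)) (sym (value y)) (value-mono qx<qy)
    to : ∀ x y → lookup p (lookup indices x) < lookup p (lookup indices y) →
         lookup [1324] x < lookup [1324] y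
    to x y px<py with Fin.<-cmp (lookup [1324] x) (lookup [1324] y)
    ... | tri< qx<qy _ _ = qx<qy
    ... | tri≈ _ qx≡qy _ = contradiction px<py
      (Fin.<-irrefl (trans (value x) (trans (cong (lookup values) qx≡qy) (sym (value y)))))
    ... | tri> _ _ qy<qx = contradiction px<py (Fin.<-asym (from y x qy<qx))

-- Pigeonhole: if `v` were missed, punching it out of the codomain would inject `Fin (suc n)` into
-- `Fin n`.
injective⇒preimage : ∀ {n} (f : Fin n → Fin n) → Injective _≡_ _≡_ f → ∀ v → ∃ λ i → f i ≡ v
injective⇒preimage {suc n} f inj v with Fin.any? (λ i → f i Fin.≟ v)
... | yes hit  = hit
... | no  miss = contradiction (Fin.injective⇒≤ punched-injective) (ℕ.<⇒≱ (ℕ.n<1+n n))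
  where
  v≢f : ∀ i → v ≢ f i
  v≢f i v≡fi = miss (i , sym v≡fi)
  punched-injective : Injective _≡_ _≡_ (λ i → Fin.punchOut (v≢f i))
  punched-injective {i} {j} e = inj (Fin.punchOut-injective (v≢f i) (v≢f j) e)

-- Colouring the entries of an avoider

module Colouring {n : ℕ} (f : Fin n → Fin n) where

  Peak : (Fin n → Colour) → Fin n → Set
  Peak c i = ∃₂ λ r s → r < s × s < i × f r < f i × f i < f s × c s ≡ red

  Forced : (Fin n → Colour) → Fin n → Set
  Forced c i = (∃ λ j → j < i × f j < f i × c j ≡ blue) ⊎ Peak c i

  forced? : ∀ c i → Dec (Forced c i)
  forced? c i =
    Fin.any? (λ j → (j Fin.<? i) ×-dec (f j Fin.<? f i) ×-dec (c j ≟ᶜ blue))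
    ⊎-dec
    Fin.any? λ r → Fin.any? λ s → (r Fin.<? s) ×-dec (s Fin.<? i) ×-dec
      (f r Fin.<? f i) ×-dec (f i Fin.<? f s) ×-dec (c s ≟ᶜ red)

  -- The rule reads only colours to the left of `i`. This makes it a valid recursion from left to
  -- right, and keeps earlier positions correct when a later one is recoloured.
  forced-cong : ∀ {c d i} → (∀ j → j < i → c j ≡ d j) → Forced c i → Forced d i
  forced-cong e (inj₁ (j , j<i , fj<fi , cj)) =
    inj₁ (j , j<i , fj<fi , trans (sym (e j j<i)) cj)
  forced-cong e (inj₂ (r , s , r<s , s<i , fr<fi , fi<fs , cs)) =
    inj₂ (r , s , r<s , s<i , fr<fi , fi<fs , trans (sym (e s s<i)) cs)

  Follows : (Fin n → Colour) → Fin n → Set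
  Follows c i = (c i ≡ blue → Forced c i) × (c i ≡ red → ¬ Forced c i)

  -- The rule is enforced one position at a time: step `k` recolours position `k` alone, as the
  -- colours before it dictate.
  colouring-below : ∀ k → ∃ λ c → ∀ i → toℕ i ℕ.< k → Follows c i
  -- The initial `red` is a placeholder, overwritten or confirmed when its position is reached.
  colouring-below zero = (λ _ → red) , λ _ ()
  colouring-below (suc k) with colouring-below k
  ... | c , follows = d , λ i i<1+k →
    follows-d i (ℕ.<-cmp (toℕ i) k) (ℕ.≤-pred i<1+k)
    where
    choose : ∀ i → Dec (toℕ i ≡ k) → Dec (Forced c i) → Colour
    choose i (no  _) _       = c i
    choose i (yes _) (yes _) = blue
    choose i (yes _) (no  _) = red
    d : Fin n → Colour
    d i = choose i (toℕ i ℕ.≟ k) (forced? c i)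
    c≡d : ∀ i → toℕ i ℕ.< k → c i ≡ d i
    c≡d i i<k with toℕ i ℕ.≟ k
    ... | no  _  = refl
    ... | yes i≡k = contradiction i<k (ℕ.<-irrefl i≡k)
    follows-k : ∀ i → toℕ i ≡ k → (d i ≡ blue → Forced c i) × (d i ≡ red → ¬ Forced c i)
    follows-k i i≡k with toℕ i ℕ.≟ k | forced? c i
    ... | no i≢k | _     = contradiction i≡k i≢k
    ... | yes _  | yes F = (λ _ → F) , λ ()
    ... | yes _  | no ¬F = (λ ()) , λ _ → ¬F
    transfer : ∀ i → toℕ i ℕ.≤ k → (Forced c i → Forced d i) × (Forced d i → Forced c i)
    transfer i i≤k = forced-cong (λ j j<i → c≡d j (ℕ.<-≤-trans j<i i≤k))
      , forced-cong (λ j j<i → sym (c≡d j (ℕ.<-≤-trans j<i i≤k)))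
    follows-d : ∀ i → Tri (toℕ i ℕ.< k) (toℕ i ≡ k) (toℕ i ℕ.> k) → toℕ i ℕ.≤ k → Follows d i
    follows-d i (tri< i<k _ _) i≤k =
      proj₁ (transfer i i≤k) ∘ proj₁ (follows i i<k) ∘ trans (c≡d i i<k)
      , λ di F → proj₂ (follows i i<k) (trans (c≡d i i<k) di) (proj₂ (transfer i i≤k) F)
    follows-d i (tri≈ _ i≡k _) i≤k =
      proj₁ (transfer i i≤k) ∘ proj₁ (follows-k i i≡k)
      , λ di F → proj₂ (follows-k i i≡k) di (proj₂ (transfer i i≤k) F)
    follows-d i (tri> _ _ i>k) i≤k = contradiction i≤k (ℕ.<⇒≱ i>k)

  colouring : ∃ λ c → ∀ i → Follows c i
  colouring = map₂ (λ h i → h i (Fin.toℕ<n i)) (colouring-below n)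

  module Coloured {c : Fin n → Colour} (follows : ∀ i → Follows c i) where

    blue-upward : ∀ {i j} → i < j → f i < f j → c i ≡ blue → c j ≡ blue
    blue-upward {i} {j} i<j fi<fj ci with c j in cj
    ... | blue = refl
    ... | red  = contradiction (inj₁ (i , i<j , fi<fj , ci)) (proj₂ (follows j) cj)

    red-downward : ∀ {i j} → i < j → f i < f j → c j ≡ red → c i ≡ red
    red-downward {i} i<j fi<fj cj with c i in ci
    ... | red  = refl
    ... | blue with () ← trans (sym cj) (blue-upward i<j fi<fj ci)

    red-avoids-132 : ∀ {i j k} → i < j → j < k → f i < f k → f k < f j →
                     c i ≡ red → c j ≡ red → c k ≡ red → ⊥
    red-avoids-132 {i} {j} {k} i<j j<k fi<fk fk<fj _ cj ck =
      proj₂ (follows k) ck (inj₂ (i , j , i<j , j<k , fi<fk , fk<fj , cj))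

    -- Blue can only originate at a peak: passing from a blue entry to the earlier, smaller blue one
    -- that forces it must stop, and it stops at an entry coloured because of a 132.
    blue-source : ∀ x → c x ≡ blue → ∃ λ y → y ≤ x × f y ≤ f x × Peak c y
    blue-source x = go x (<-wellFounded x)
      where
      go : ∀ x → Acc _<_ x → c x ≡ blue → ∃ λ y → y ≤ x × f y ≤ f x × Peak c y
      go x (acc rec) cx with proj₁ (follows x) cx
      ... | inj₂ peak = x , ℕ.≤-refl , ℕ.≤-refl , peak
      ... | inj₁ (j , j<x , fj<fx , cj) with go j (rec j<x) cj
      ... | y , y≤j , fy≤fj , peak =
        y , ℕ.≤-trans y≤j (ℕ.<⇒≤ j<x) , ℕ.≤-trans fy≤fj (ℕ.<⇒≤ fj<fx) , peak

    red-after-blue : ∀ {i j} → i < j → c i ≡ blue → c j ≡ red → f j ≤ f i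
    red-after-blue i<j ci cj = ℕ.≮⇒≥ λ fi<fj →
      contradiction (trans (sym cj) (blue-upward i<j fi<fj ci)) λ ()

    -- The source `w` of `y` ends a 132 at `r`, `s`, `w` with `s` red. Wherever `r` lies relative to
    -- `x`, this 132 and the 213 together contain a 1324 that ends at `z`.
    blue-avoids-213 : Avoids1324 f → ∀ {x y z} → x < y → y < z → f y < f x → f x < f z →
                      c x ≡ blue → c y ≡ blue → c z ≡ blue → ⊥
    blue-avoids-213 avoids {x} {y} {z} x<y y<z fy<fx fx<fz cx cy _
      with w , w≤y , fw≤fy , r , s , r<s , s<w , fr<fw , fw<fs , cs ← blue-source y cy
      with r Fin.<? x
    -- The 1324 is at `r`, `x`, `y`, `z`, since `f r < f w ≤ f y`.
    ... | yes r<x = avoids r<x x<y y<z (ℕ.<-≤-trans fr<fw fw≤fy) fy<fx fx<fz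
    -- Now the red `s` comes after the blue `x`, so `f s ≤ f x < f z`, and the 1324 is at `r`, `s`,
    -- `w`, `z`.
    ... | no  r≮x = avoids r<s s<w (ℕ.≤-<-trans w≤y y<z) fr<fw fw<fs
      (ℕ.≤-<-trans (red-after-blue (ℕ.≤-<-trans (ℕ.≮⇒≥ r≮x) r<s) cx cs) fx<fz)

-- The two words determine an avoider

-- Reversing both orders turns 213 into 132 and right-to-left maxima into left-to-right
-- minima, so one argument, for an arbitrary order _≺_, covers both colours.
module Class {n : ℕ} (_≺_ : Rel (Fin n) 0ℓ) (c : Colour) (f : Fin n → Fin n)
             (w : Vec Letter n) where

  record IsClass : Set where
    field
      outer-minimal : ∀ {i} → lookup w i ≡ (c , outer) → ∀ a → a ≺ i → ¬ (f a ≺ f i)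
      inner-above   : ∀ {i} → lookup w i ≡ (c , inner) →
                      ∃ λ a → a ≺ i × f a ≺ f i × proj₁ (lookup w a) ≡ c
      avoids-132    : ∀ {i j k} → i ≺ j → j ≺ k → f i ≺ f k → f k ≺ f j →
                      proj₁ (lookup w i) ≡ c → proj₁ (lookup w j) ≡ c →
                      proj₁ (lookup w k) ≡ c → ⊥

open Class using (IsClass)

Labels : ∀ {n} → (Fin n → Fin n) → Vec Letter n → Vec Letter n → Set
Labels f w z = ∀ i → lookup w i ≡ lookup z (f i)

module Determined {n : ℕ} {_≺_ : Rel (Fin n) 0ℓ} (≺-wf : WellFounded _≺_)
                  (≺-cmp : Trichotomous _≡_ _≺_) {c : Colour} {w z : Vec Letter n} where

  ≺-irrefl : ∀ {i j} → i ≡ j → ¬ (i ≺ j)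
  ≺-irrefl {i} {j} i≡j i≺j with ≺-cmp i j
  ... | tri< _ i≢j _ = i≢j i≡j
  ... | tri≈ i⊀j _ _ = i⊀j i≺j
  ... | tri> i⊀j _ _ = i⊀j i≺j

  AgreeBelow : (f g : Fin n → Fin n) → Fin n → Set
  AgreeBelow f g i = ∀ {j} → j ≺ i → proj₁ (lookup w j) ≡ c → f j ≡ g j

  not-below : ∀ {f g i} → Injective _≡_ _≡_ f → Injective _≡_ _≡_ g →
              Labels f w z → Labels g w z → IsClass _≺_ c f w → IsClass _≺_ c g w →
              AgreeBelow f g i → proj₁ (lookup w i) ≡ c → ¬ (f i ≺ g i)
  not-below {f} {g} {i} f-inj g-inj f-lab g-lab F G ih wi fi≺gi with lookup w i in e
  -- Let `f` take the value `g i` at `j`. The letter of that value in `z` is the letter of `i`, so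
  -- `j` is an outer entry of the same colour.
  ... | c′ , outer with refl ← wi with injective⇒preimage f f-inj (g i)
  ... | j , fj≡gi with trans (f-lab j) (trans (cong (lookup z) fj≡gi) (sym (g-lab i))) | ≺-cmp j i
  ... | wj≡wi | tri< j≺i _ _ =
    ≺-irrefl (g-inj (trans (sym (ih j≺i (cong proj₁ (trans wj≡wi e)))) fj≡gi)) j≺i
  ... | wj≡wi | tri≈ _ j≡i _ = ≺-irrefl (trans (cong f (sym j≡i)) fj≡gi) fi≺gi
  -- The earlier, smaller `f i` contradicts the minimality of `f j`.
  ... | wj≡wi | tri> _ _ i≺j =
    IsClass.outer-minimal F (trans wj≡wi e) i i≺j (subst (f i ≺_) (sym fj≡gi) fi≺gi)
  -- With the roles exchanged, `g` takes the value `f i` at an inner `j` of the same colour.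
  not-below {f} {g} {i} f-inj g-inj f-lab g-lab F G ih wi fi≺gi | c′ , inner
    with refl ← wi with injective⇒preimage g g-inj (f i)
  ... | j , gj≡fi with trans (g-lab j) (trans (cong (lookup z) gj≡fi) (sym (f-lab i))) | ≺-cmp j i
  ... | wj≡wi | tri< j≺i _ _ =
    ≺-irrefl (f-inj (trans (ih j≺i (cong proj₁ (trans wj≡wi e))) gj≡fi)) j≺i
  ... | wj≡wi | tri≈ _ j≡i _ = ≺-irrefl (trans (sym gj≡fi) (cong g j≡i)) fi≺gi
  -- The entry `a` below `i` has the same value under `f` and `g`, so `g` has a 132 of colour `c` at
  -- `a`, `i`, `j`.
  ... | wj≡wi | tri> _ _ i≺j with a , a≺i , fa≺fi , wa ← IsClass.inner-above F e =
    IsClass.avoids-132 G a≺i i≺j (subst₂ _≺_ (ih a≺i wa) (sym gj≡fi) fa≺fi)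
      (subst (_≺ g i) (sym gj≡fi) fi≺gi) wa (cong proj₁ e) (cong proj₁ (trans wj≡wi e))

  module _ {f g : Fin n → Fin n} (f-inj : Injective _≡_ _≡_ f) (g-inj : Injective _≡_ _≡_ g)
           (f-lab : Labels f w z) (g-lab : Labels g w z)
           (F : IsClass _≺_ c f w) (G : IsClass _≺_ c g w) where

    agree : ∀ {i} → proj₁ (lookup w i) ≡ c → f i ≡ g i
    agree {i} = go (≺-wf i)
      where
      go : ∀ {i} → Acc _≺_ i → proj₁ (lookup w i) ≡ c → f i ≡ g i
      go {i} (acc rec) wi with ≺-cmp (f i) (g i)
      ... | tri≈ _ fi≡gi _ = fi≡gi
      ... | tri< fi≺gi _ _ = contradiction fi≺gi
        (not-below f-inj g-inj f-lab g-lab F G (λ j≺i wj → go (rec j≺i) wj) wi)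
      ... | tri> _ _ gi≺fi = contradiction gi≺fi
        (not-below g-inj f-inj g-lab f-lab G F (λ j≺i wj → sym (go (rec j≺i) wj)) wi)

-- A relation instead of an encoding function, because the words are built from proofs that `f` is
-- injective and avoids 1324. The blue class takes the reversed order.
record Codes {n : ℕ} (f : Fin n → Fin n) (w z : Vec Letter n) : Set where
  field
    labels     : Labels f w z
    red-class  : IsClass _<_ red f w
    blue-class : IsClass _>_ blue f w

>-cmp : ∀ {n} → Trichotomous {A = Fin n} _≡_ _>_
>-cmp i j with Fin.<-cmp i j
... | tri< i<j i≢j i≯j = tri> i≯j i≢j i<j
... | tri≈ i≮j i≡j i≯j = tri≈ i≯j i≡j i≮j
... | tri> i≮j i≢j i>j = tri< i>j i≢j i≮j

codes-injective : ∀ {n} {f g : Fin n → Fin n} {w z} → Injective _≡_ _≡_ f → Injective _≡_ _≡_ g →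
                  Codes f w z → Codes g w z → ∀ i → f i ≡ g i
codes-injective {w = w} {z} f-inj g-inj F G i with proj₁ (lookup w i) in wi
... | red  = Determined.agree <-wellFounded Fin.<-cmp {z = z} f-inj g-inj (labels F) (labels G)
    (red-class F) (red-class G) wi
  where open Codes
... | blue = Determined.agree >-wellFounded >-cmp {z = z} f-inj g-inj (labels F) (labels G)
    (blue-class F) (blue-class G) wi
  where open Codes

-- The two words of an avoider are admissible

data Forbidden : Letter → Letter → Set where
  descent : Forbidden (blue , inner) (red , inner)

forbidden⇒≡ : ∀ {k l} → Forbidden k l → k ≡ (blue , inner) × l ≡ (red , inner)
forbidden⇒≡ descent = refl , refl

Consecutive : ∀ {n} → Fin n → Fin n → Set
Consecutive i j = toℕ j ≡ suc (toℕ i)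

-- The virtual letter (blue , inner) in front forbids (red , inner) as first letter.
Admissible : ∀ {n} → Letter → Vec Letter n → Set
Admissible s w = ∀ i j → Consecutive i j → ¬ Forbidden (lookup (s ∷ w) i) (lookup (s ∷ w) j)

module Encoding {n : ℕ} {f : Fin n → Fin n} (f-inj : Injective _≡_ _≡_ f)
                (avoids : Avoids1324 f) where
  open Colouring f

  c : Fin n → Colour
  c = proj₁ colouring

  open Coloured (proj₂ colouring)

  Inner : Colour → Fin n → Set
  Inner red  i = ∃ λ a → a < i × f a < f i
  Inner blue i = ∃ λ a → a > i × f a > f i

  inner? : ∀ d i → Dec (Inner d i)
  inner? red  i = Fin.any? λ a → (a Fin.<? i) ×-dec (f a Fin.<? f i)
  inner? blue i = Fin.any? λ a → (i Fin.<? a) ×-dec (f i Fin.<? f a)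

  kind : ∀ {P : Set} → Dec P → Kind
  kind (yes _) = inner
  kind (no  _) = outer

  kind-inner : ∀ {P : Set} (P? : Dec P) → kind P? ≡ inner → P
  kind-inner (yes p) _ = p

  kind-outer : ∀ {P : Set} (P? : Dec P) → kind P? ≡ outer → ¬ P
  kind-outer (no ¬p) _ = ¬p

  label : Fin n → Letter
  label i = c i , kind (inner? (c i) i)

  label-inner : ∀ {i d} → label i ≡ (d , inner) → c i ≡ d × Inner d i
  label-inner {i} e with cong proj₁ e
  ... | refl = refl , kind-inner (inner? (c i) i) (cong proj₂ e)

  label-outer : ∀ {i d} → label i ≡ (d , outer) → ¬ Inner d i
  label-outer {i} e with cong proj₁ e
  ... | refl = kind-outer (inner? (c i) i) (cong proj₂ e)

  position : Fin n → Fin n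
  position v = proj₁ (injective⇒preimage f f-inj v)

  f-position : ∀ v → f (position v) ≡ v
  f-position v = proj₂ (injective⇒preimage f f-inj v)

  w z : Vec Letter n
  w = tabulate label
  z = tabulate (label ∘ position)

  w-label : ∀ i → lookup w i ≡ label i
  w-label = Vec.lookup∘tabulate label

  z-label : ∀ v → lookup z v ≡ label (position v)
  z-label = Vec.lookup∘tabulate (label ∘ position)

  c⇒w : ∀ {i d} → c i ≡ d → proj₁ (lookup w i) ≡ d
  c⇒w {i} = trans (cong proj₁ (w-label i))

  w⇒c : ∀ {i d} → proj₁ (lookup w i) ≡ d → c i ≡ d
  w⇒c {i} = trans (cong proj₁ (sym (w-label i)))

  w-inner : ∀ {i d} → lookup w i ≡ (d , inner) → c i ≡ d × Inner d i
  w-inner {i} e = label-inner (trans (sym (w-label i)) e)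

  w-outer : ∀ {i d} → lookup w i ≡ (d , outer) → ¬ Inner d i
  w-outer {i} e = label-outer (trans (sym (w-label i)) e)

  z-inner : ∀ {v d} → lookup z v ≡ (d , inner) →
            c (position v) ≡ d × Inner d (position v)
  z-inner {v} e = label-inner (trans (sym (z-label v)) e)

  codes : Codes f w z
  codes = record
    { labels = λ i → trans (w-label i) (sym (trans (z-label (f i))
        (cong label (f-inj (f-position (f i))))))
    ; red-class = record
      { outer-minimal = λ {i} e a a<i fa<fi → w-outer {i} e (a , a<i , fa<fi)
      ; inner-above = λ {i} e → red-inner (w-inner {i} e)
      ; avoids-132 = λ i<j j<k fi<fk fk<fj wi wj wk →
          red-avoids-132 i<j j<k fi<fk fk<fj (w⇒c wi) (w⇒c wj) (w⇒c wk)
      }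
    ; blue-class = record
      { outer-minimal = λ {i} e a a>i fa>fi → w-outer {i} e (a , a>i , fa>fi)
      ; inner-above = λ {i} e → blue-inner (w-inner {i} e)
      -- In the reversed order a 132 at `i`, `j`, `k` is a 213 at `k`, `j`, `i`.
      ; avoids-132 = λ i>j j>k fi>fk fk>fj wi wj wk →
          blue-avoids-213 avoids j>k i>j fk>fj fi>fk (w⇒c wk) (w⇒c wj) (w⇒c wi)
      }
    }
    where
    -- The witness in `Inner` comes without a colour; it has the right one because red spreads down
    -- to the left and blue up to the right.
    red-inner : ∀ {i} → c i ≡ red × Inner red i →
                ∃ λ a → a < i × f a < f i × proj₁ (lookup w a) ≡ red
    red-inner (ci , a , a<i , fa<fi) = a , a<i , fa<fi , c⇒w (red-downward a<i fa<fi ci)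
    blue-inner : ∀ {i} → c i ≡ blue × Inner blue i →
                 ∃ λ a → a > i × f a > f i × proj₁ (lookup w a) ≡ blue
    blue-inner (ci , a , a>i , fa>fi) = a , a>i , fa>fi , c⇒w (blue-upward a>i fa>fi ci)

  -- A forbidden factor at `i`, `j` gives a 1324 at `a`, `i`, `j`, `d`, with `a` before and below
  -- `j` and `d` after and above `i`. As `i` and `j` are adjacent and `f j ≤ f i`, these witnesses
  -- lie outside the pair.
  w-admissible : Admissible (blue , inner) w
  -- The first entry has nothing before it, so it is not red inner.
  w-admissible zero (suc zero) refl bad
    with _ , _ , () , _ ← w-inner {zero} (proj₂ (forbidden⇒≡ bad))
  w-admissible (suc i) (suc j) eq bad
    with ci , d , d>i , fd>fi ← w-inner {i} (proj₁ (forbidden⇒≡ bad))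
       | cj , a , a<j , fa<fj ← w-inner {j} (proj₂ (forbidden⇒≡ bad)) =
    avoids
      (ℕ.≤∧≢⇒< (ℕ.≤-pred (subst (toℕ a ℕ.<_) j≡1+i a<j)) λ a≡i →
        ℕ.<⇒≱ fa<fj
          (subst (λ t → f j ≤ f t) (sym (Fin.toℕ-injective a≡i)) (red-after-blue i<j ci cj)))
      i<j
      (ℕ.≤∧≢⇒< (subst (ℕ._≤ toℕ d) (sym j≡1+i) d>i) λ j≡d →
        ℕ.<⇒≱ fd>fi
          (subst (λ t → f t ≤ f i) (Fin.toℕ-injective j≡d) (red-after-blue i<j ci cj)))
      fa<fj
      (ℕ.≤∧≢⇒< (red-after-blue i<j ci cj) λ fj≡fi →
        Fin.<-irrefl (f-inj (Fin.toℕ-injective (sym fj≡fi))) i<j)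
      fd>fi
    where
    j≡1+i : toℕ j ≡ suc (toℕ i)
    j≡1+i = ℕ.suc-injective eq
    i<j : i < j
    i<j = ℕ.≤-reflexive (sym j≡1+i)

  -- Since `f j` exceeds `f i`, the red `j` cannot come after the blue `i`. Hence `a`, `j`, `i`, `d`
  -- is a 1324: no value fits between `f i` and `f j`, so `f a` and `f d` lie outside them.
  not-adjacent-values : ∀ {i j} → toℕ (f j) ≡ suc (toℕ (f i)) →
                         c i ≡ blue × Inner blue i → c j ≡ red × Inner red j → ⊥
  not-adjacent-values {i} {j} fj≡1+fi (ci , d , d>i , fd>fi) (cj , a , a<j , fa<fj) =
    avoids a<j j<i d>i
      (ℕ.≤∧≢⇒< (ℕ.≤-pred (subst (toℕ (f a) ℕ.<_) fj≡1+fi fa<fj)) λ fa≡fi →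
        Fin.<-asym j<i (subst (_< j) (f-inj (Fin.toℕ-injective fa≡fi)) a<j))
      fi<fj
      (ℕ.≤∧≢⇒< (subst (ℕ._≤ toℕ (f d)) (sym fj≡1+fi) fd>fi) λ fj≡fd →
        Fin.<-asym j<i (subst (i <_) (sym (f-inj (Fin.toℕ-injective fj≡fd))) d>i))
    where
    fi<fj : f i < f j
    fi<fj = ℕ.≤-reflexive (sym fj≡1+fi)
    j<i : j < i
    j<i with Fin.<-cmp i j
    ... | tri< i<j _ _ = contradiction fi<fj (ℕ.≤⇒≯ (red-after-blue i<j ci cj))
    ... | tri≈ _ i≡j _ = contradiction fi<fj (Fin.<-irrefl (cong f i≡j))
    ... | tri> _ _ j<i = j<i

  z-admissible : Admissible (blue , inner) z
  -- The entry of value 0 has nothing below it, so it is not red inner.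
  z-admissible zero (suc zero) refl bad
    with _ , a , _ , fa<0 ← z-inner {zero} (proj₂ (forbidden⇒≡ bad))
    with () ← subst (f a <_) (f-position zero) fa<0
  z-admissible (suc u) (suc v) eq bad = not-adjacent-values
    (trans (cong toℕ (f-position v)) (trans (ℕ.suc-injective eq)
      (cong (suc ∘ toℕ) (sym (f-position u)))))
    (z-inner {u} (proj₁ (forbidden⇒≡ bad))) (z-inner {v} (proj₂ (forbidden⇒≡ bad)))

-- Counting admissible words

module _ {A : Set} where

  lookup-injective : ∀ {xs : List A} → Uniqueᴸ xs → Injective _≡_ _≡_ (List.lookup xs)
  lookup-injective (_ AllPairs.∷ _)    {zero}  {zero}  _ = refl
  lookup-injective (x∉ AllPairs.∷ _)   {zero}  {suc j} e =
    contradiction e (All.lookup x∉ (∈-lookup j))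
  lookup-injective (x∉ AllPairs.∷ _)   {suc i} {zero}  e =
    contradiction (sym e) (All.lookup x∉ (∈-lookup i))
  lookup-injective (_ AllPairs.∷ uniq) {suc i} {suc j} e =
    cong suc (lookup-injective uniq e)

  -- Sending an index of `xs` to the index of a chosen partner is an injection between finite sets.
  length-≤ : ∀ {B : Set} {R : A → B → Set} {xs : List A} {ys : List B} → Uniqueᴸ xs →
             (∀ {x} → x ∈ xs → ∃ λ y → y ∈ ys × R x y) →
             (∀ {x x′ y} → x ∈ xs → x′ ∈ xs → R x y → R x′ y → x ≡ x′) →
             length xs ℕ.≤ length ys
  length-≤ {R = R} {xs} {ys} uniq total inj = Fin.injective⇒≤ image-injective
    where
    partner : ∀ i → ∃ λ y → y ∈ ys × R (List.lookup xs i) y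
    partner i = total (∈-lookup i)
    image : Fin (length xs) → Fin (length ys)
    image i = Any.index (proj₁ (proj₂ (partner i)))
    related : ∀ i → R (List.lookup xs i) (List.lookup ys (image i))
    related i = subst (R _) (lookup-index (proj₁ (proj₂ (partner i)))) (proj₂ (proj₂ (partner i)))
    image-injective : Injective _≡_ _≡_ image
    image-injective {i} {j} e = lookup-injective uniq (inj (∈-lookup i) (∈-lookup j) (related i)
      (subst (R _) (cong (List.lookup ys) (sym e)) (related j)))

  length-concatMap : ∀ {B : Set} (f : B → List A) xs →
                     length (concatMap f xs) ≡ sum (List.map (length ∘ f) xs)
  length-concatMap f []       = refl
  length-concatMap f (x ∷ xs) =
    trans (List.length-++ (f x)) (cong (length (f x) ℕ.+_) (length-concatMap f xs))

  length-cartesianProduct : ∀ {B : Set} (xs : List A) (ys : List B) →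
                            length (List.cartesianProduct xs ys) ≡ length xs ℕ.* length ys
  length-cartesianProduct []       ys = refl
  length-cartesianProduct (x ∷ xs) ys = trans (List.length-++ (List.map (x ,_) ys))
    (cong₂ ℕ._+_ (List.length-map (x ,_) ys) (length-cartesianProduct xs ys))

letters : List Letter
letters = (red , outer) ∷ (red , inner) ∷ (blue , outer) ∷ (blue , inner) ∷ []

∈-letters : ∀ l → l ∈ letters
∈-letters (red  , outer) = here refl
∈-letters (red  , inner) = there (here refl)
∈-letters (blue , outer) = there (there (here refl))
∈-letters (blue , inner) = there (there (there (here refl)))

follow : Letter → List Letter
follow (blue , inner) = (red , outer) ∷ (blue , outer) ∷ (blue , inner) ∷ []
follow _              = letters

∈-follow : ∀ s l → ¬ Forbidden s l → l ∈ follow s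
∈-follow (blue , inner) (red  , outer) _   = here refl
∈-follow (blue , inner) (red  , inner) ok  = contradiction descent ok
∈-follow (blue , inner) (blue , outer) _   = there (here refl)
∈-follow (blue , inner) (blue , inner) _   = there (there (here refl))
∈-follow (blue , outer) l _ = ∈-letters l
∈-follow (red  , outer) l _ = ∈-letters l
∈-follow (red  , inner) l _ = ∈-letters l

free : Letter → ∀ n → List (Vec Letter n)
free s zero    = [] ∷ []
free s (suc n) = concatMap (λ l → List.map (l ∷_) (free l n)) (follow s)

∈-free : ∀ {n} s (w : Vec Letter n) → Admissible s w → w ∈ free s n
∈-free s []      _  = here refl
∈-free s (l ∷ w) ok = ∈-concatMap⁺ (λ l → List.map (l ∷_) (free l _))
  (Any.map (λ { refl → ∈-map⁺ (l ∷_) (∈-free l w λ i j → ok (suc i) (suc j) ∘ cong suc) })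
    (∈-follow s l (ok zero (suc zero) refl)))

-- (2 + √3)ⁿ = x n + y n √3
x y : ℕ → ℕ
x zero    = 1
x (suc n) = 2 ℕ.* x n ℕ.+ 3 ℕ.* y n
y zero    = 0
y (suc n) = x n ℕ.+ 2 ℕ.* y n

0<x : ∀ n → 0 ℕ.< x n
0<x zero    = ℕ.z<s
0<x (suc n) = ℕ.<-≤-trans (0<x n) (ℕ.≤-trans (ℕ.m≤m+n (x n) _) (ℕ.m≤m+n (2 ℕ.* x n) _))

0<y : ∀ n .{{_ : NonZero n}} → 0 ℕ.< y n
0<y (suc n) = ℕ.<-≤-trans (0<x n) (ℕ.m≤m+n (x n) _)

-- Closed form of the number of words that may follow a letter. With B for blue inner and A for any
-- other letter, A becomes 3A + B and B becomes 2A + B when the length grows by one; this matrix has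
-- eigenvalues 2 ± √3.
size : Letter → ℕ → ℕ
size (blue , inner) n = x n ℕ.+ y n
size _              n = x n ℕ.+ 2 ℕ.* y n

length-free : ∀ s n → length (free s n) ≡ size s n
length-free s zero    = sym (size-zero s)
  where
  size-zero : ∀ s → size s 0 ≡ 1
  size-zero (red  , outer) = refl
  size-zero (red  , inner) = refl
  size-zero (blue , outer) = refl
  size-zero (blue , inner) = refl
length-free s (suc n) = begin
  length (concatMap (λ l → List.map (l ∷_) (free l n)) (follow s))
    ≡⟨ length-concatMap (λ l → List.map (l ∷_) (free l n)) (follow s) ⟩
  sum (List.map (λ l → length (List.map (l ∷_) (free l n))) (follow s))
    ≡⟨ cong sum (List.map-cong (λ l → trans (List.length-map (l ∷_) (free l n)) (length-free l n))
         (follow s)) ⟩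
  sum (List.map (λ l → size l n) (follow s))
    ≡⟨ sum-sizes s ⟩
  size s (suc n) ∎
  where
  open ≡-Reasoning
  open +-*-Solver
  three : ∀ a b → (a ℕ.+ 2 ℕ.* b) ℕ.+ ((a ℕ.+ 2 ℕ.* b) ℕ.+ ((a ℕ.+ b) ℕ.+ 0))
                  ≡ (2 ℕ.* a ℕ.+ 3 ℕ.* b) ℕ.+ (a ℕ.+ 2 ℕ.* b)
  three = solve 2 (λ a b →
    (a :+ con 2 :* b) :+ ((a :+ con 2 :* b) :+ ((a :+ b) :+ con 0))
    := (con 2 :* a :+ con 3 :* b) :+ (a :+ con 2 :* b)) refl
  four : ∀ a b → (a ℕ.+ 2 ℕ.* b) ℕ.+ ((a ℕ.+ 2 ℕ.* b) ℕ.+ ((a ℕ.+ 2 ℕ.* b) ℕ.+ ((a ℕ.+ b) ℕ.+ 0)))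
                 ≡ (2 ℕ.* a ℕ.+ 3 ℕ.* b) ℕ.+ 2 ℕ.* (a ℕ.+ 2 ℕ.* b)
  four = solve 2 (λ a b →
    (a :+ con 2 :* b) :+ ((a :+ con 2 :* b) :+ ((a :+ con 2 :* b) :+ ((a :+ b) :+ con 0)))
    := (con 2 :* a :+ con 3 :* b) :+ con 2 :* (a :+ con 2 :* b)) refl
  sum-sizes : ∀ s → sum (List.map (λ l → size l n) (follow s)) ≡ size s (suc n)
  sum-sizes (red  , outer) = four (x n) (y n)
  sum-sizes (red  , inner) = four (x n) (y n)
  sum-sizes (blue , outer) = four (x n) (y n)
  sum-sizes (blue , inner) = three (x n) (y n)

words-unique : ∀ n k → Uniqueᴸ (words n k)
words-unique n zero    = All.[] AllPairs.∷ AllPairs.[]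
words-unique n (suc k) =
  Uniqueᴸ.cartesianProductWith⁺ _∷_ Vec.∷-injective (Uniqueᴸ.allFin⁺ n) (words-unique n k)

S-bound : ∀ n → S n [1324] ℕ.≤ (x n ℕ.+ y n) ℕ.* (x n ℕ.+ y n)
S-bound n = begin
  length avoiders
    ≤⟨ length-≤ {R = λ p (w , z) → Codes (lookup p) w z} avoiders-unique encode decode ⟩
  length (List.cartesianProduct (free front n) (free front n))
    ≡⟨ length-cartesianProduct (free front n) (free front n) ⟩
  length (free front n) ℕ.* length (free front n)
    ≡⟨ cong (λ m → m ℕ.* m) (length-free front n) ⟩
  (x n ℕ.+ y n) ℕ.* (x n ℕ.+ y n) ∎
  where
  open ℕ.≤-Reasoning
  front : Letter
  front = blue , inner
  avoiders : List (Vec (Fin n) n)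
  avoiders = List.filter (avoids? [1324]) (permutations n)
  avoiders-unique : Uniqueᴸ avoiders
  avoiders-unique = Uniqueᴸ.filter⁺ (avoids? [1324])
    (Uniqueᴸ.filter⁺ isPermutation? (words-unique n n))
  avoids : ∀ {p} → p ∈ avoiders → Avoids1324 (lookup p)
  avoids {p} p∈ = avoids⇒avoids1324 p
    (proj₂ (∈-filter⁻ (avoids? [1324]) {xs = permutations n} p∈))
  injective : ∀ {p} → p ∈ avoiders → Injective _≡_ _≡_ (lookup p)
  injective p∈ {i} {j} = Uniqueⱽ.lookup-injective
    (proj₂ (∈-filter⁻ isPermutation? {xs = words n n}
      (proj₁ (∈-filter⁻ (avoids? [1324]) {xs = permutations n} p∈)))) i j
  encode : ∀ {p} → p ∈ avoiders →
           ∃ λ ((w , z) : Vec Letter n × Vec Letter n) →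
             (w , z) ∈ List.cartesianProduct (free front n) (free front n) × Codes (lookup p) w z
  encode p∈ = (w , z)
    , ∈-cartesianProduct⁺ (∈-free front w w-admissible) (∈-free front z z-admissible)
    , codes
    where open Encoding (injective p∈) (avoids p∈)
  decode : ∀ {p q wz} → p ∈ avoiders → q ∈ avoiders →
           Codes (lookup p) (proj₁ wz) (proj₂ wz) → Codes (lookup q) (proj₁ wz) (proj₂ wz) → p ≡ q
  decode {p} {q} p∈ q∈ P Q = trans (sym (Vec.tabulate∘lookup p)) (trans
    (Vec.tabulate-cong (codes-injective (injective p∈) (injective q∈) P Q)) (Vec.tabulate∘lookup q))

-- Rational approximations of powers of a + b√m

ι : ℕ → ℚ
ι m = + m ℚ./ 1

ι-+ : ∀ a b → ι (a ℕ.+ b) ≡ ι a ℚ.+ ι b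
ι-+ zero    b = sym (ℚ.+-identityˡ (ι b))
ι-+ (suc a) b = begin
  ι (suc (a ℕ.+ b))          ≡⟨ suc-/ (a ℕ.+ b) 0 ⟩
  ι (a ℕ.+ b) ℚ.+ 1ℚ         ≡⟨ cong (ℚ._+ 1ℚ) (ι-+ a b) ⟩
  (ι a ℚ.+ ι b) ℚ.+ 1ℚ       ≡⟨ eq (ι a) (ι b) 1ℚ ⟩
  (ι a ℚ.+ 1ℚ) ℚ.+ ι b       ≡⟨ cong (ℚ._+ ι b) (suc-/ a 0) ⟨
  ι (suc a) ℚ.+ ι b          ∎
  where
  open ≡-Reasoning
  eq : ∀ p q r → (p ℚ.+ q) ℚ.+ r ≡ (p ℚ.+ r) ℚ.+ q
  eq = solve 3 (λ p q r → (p :+ q) :+ r := (p :+ r) :+ q) refl where open ℚ.+-*-Solver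

ι-* : ∀ a b → ι (a ℕ.* b) ≡ ι a ℚ.* ι b
ι-* zero    b = sym (ℚ.*-zeroˡ (ι b))
ι-* (suc a) b = begin
  ι (b ℕ.+ a ℕ.* b)          ≡⟨ ι-+ b (a ℕ.* b) ⟩
  ι b ℚ.+ ι (a ℕ.* b)        ≡⟨ cong (ι b ℚ.+_) (ι-* a b) ⟩
  ι b ℚ.+ ι a ℚ.* ι b        ≡⟨ cong (ℚ._+ ι a ℚ.* ι b) (ℚ.*-identityˡ (ι b)) ⟨
  1ℚ ℚ.* ι b ℚ.+ ι a ℚ.* ι b ≡⟨ ℚ.+-comm (1ℚ ℚ.* ι b) (ι a ℚ.* ι b) ⟩
  ι a ℚ.* ι b ℚ.+ 1ℚ ℚ.* ι b ≡⟨ ℚ.*-distribʳ-+ (ι b) (ι a) 1ℚ ⟨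
  (ι a ℚ.+ 1ℚ) ℚ.* ι b       ≡⟨ cong (ℚ._* ι b) (suc-/ a 0) ⟨
  ι (suc a) ℚ.* ι b          ∎
  where open ≡-Reasoning

ι-mono : ∀ {a b} → a ℕ.≤ b → ι a ℚ.≤ ι b
ι-mono {a} {b} a≤b = ≤-by-cross a 0 b 0 (ℕ.*-monoˡ-≤ 1 a≤b)

0≤ι : ∀ a → 0ℚ ℚ.≤ ι a
0≤ι a = ι-mono (ℕ.z≤n {a})

0≤+ : ∀ {p q} → 0ℚ ℚ.≤ p → 0ℚ ℚ.≤ q → 0ℚ ℚ.≤ p ℚ.+ q
0≤+ = ℚ.+-mono-≤

0≤* : ∀ {p q} → 0ℚ ℚ.≤ p → 0ℚ ℚ.≤ q → 0ℚ ℚ.≤ p ℚ.* q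
0≤* {p} {q} 0≤p 0≤q = subst (ℚ._≤ p ℚ.* q) (ℚ.*-zeroˡ q) (*-mono-≤₀ ℚ.≤-refl 0≤q 0≤p ℚ.≤-refl)

p≤p+ : ∀ p {q} → 0ℚ ℚ.≤ q → p ℚ.≤ p ℚ.+ q
p≤p+ p {q} 0≤q = subst (ℚ._≤ p ℚ.+ q) (ℚ.+-identityʳ p) (ℚ.+-monoʳ-≤ p 0≤q)

p≤q⇒0≤q-p : ∀ {p q} → p ℚ.≤ q → 0ℚ ℚ.≤ q ℚ.- p
p≤q⇒0≤q-p {p} {q} p≤q = subst (ℚ._≤ q ℚ.- p) (ℚ.+-inverseʳ p) (ℚ.+-monoˡ-≤ (ℚ.- p) p≤q)

∣p-q∣≡∣q-p∣ : ∀ p q → ∣ p ℚ.- q ∣ ≡ ∣ q ℚ.- p ∣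
∣p-q∣≡∣q-p∣ p q = trans (sym (ℚ.∣-p∣≡∣p∣ (p ℚ.- q))) (cong ∣_∣ (eq p q))
  where
  eq : ∀ p q → ℚ.- (p ℚ.- q) ≡ q ℚ.- p
  eq = solve 2 (λ p q → :- (p :- q) := q :- p) refl where open ℚ.+-*-Solver

-- Multiplying the bound for `X + Y s` by `A + B s` yields `B Y s²` where `B M Y` is wanted, which
-- costs `B Y (M - s²)`. The old error is multiplied by `A + B s`, at most `A + B M`.
power-step : ∀ {A B M X Y P K s} → 0ℚ ℚ.≤ A → 0ℚ ℚ.≤ B → 0ℚ ℚ.≤ X → 0ℚ ℚ.≤ Y → 0ℚ ℚ.≤ K →
  0ℚ ℚ.≤ s → s ℚ.≤ M → s ℚ.* s ℚ.≤ M →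
  X ℚ.+ Y ℚ.* s ℚ.≤ P ℚ.+ K ℚ.* (M ℚ.- s ℚ.* s) →
  (A ℚ.* X ℚ.+ B ℚ.* M ℚ.* Y) ℚ.+ (B ℚ.* X ℚ.+ A ℚ.* Y) ℚ.* s
  ℚ.≤ (A ℚ.+ B ℚ.* s) ℚ.* P ℚ.+ (B ℚ.* Y ℚ.+ (A ℚ.+ B ℚ.* M) ℚ.* K) ℚ.* (M ℚ.- s ℚ.* s)
power-step {A} {B} {M} {X} {Y} {P} {K} {s} 0≤A 0≤B 0≤X 0≤Y 0≤K 0≤s s≤M s²≤M ih = begin
  (A ℚ.* X ℚ.+ B ℚ.* M ℚ.* Y) ℚ.+ (B ℚ.* X ℚ.+ A ℚ.* Y) ℚ.* s
    ≡⟨ expand A B M X Y s ⟩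
  (A ℚ.+ B ℚ.* s) ℚ.* (X ℚ.+ Y ℚ.* s) ℚ.+ B ℚ.* Y ℚ.* d
    ≤⟨ ℚ.+-monoˡ-≤ (B ℚ.* Y ℚ.* d) (*-mono-≤₀ (0≤+ 0≤A (0≤* 0≤B 0≤s))
         (ℚ.≤-trans (0≤+ 0≤X (0≤* 0≤Y 0≤s)) ih) (ℚ.≤-refl {A ℚ.+ B ℚ.* s}) ih) ⟩
  (A ℚ.+ B ℚ.* s) ℚ.* (P ℚ.+ K ℚ.* d) ℚ.+ B ℚ.* Y ℚ.* d
    -- The added term raises the factor `A + B s` of the old error to `A + B M`, making the new
    -- coefficient independent of `s`.
    ≤⟨ p≤p+ ((A ℚ.+ B ℚ.* s) ℚ.* (P ℚ.+ K ℚ.* d) ℚ.+ B ℚ.* Y ℚ.* d)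
         (0≤* (0≤* 0≤B (p≤q⇒0≤q-p s≤M)) (0≤* 0≤K (p≤q⇒0≤q-p s²≤M))) ⟩
  ((A ℚ.+ B ℚ.* s) ℚ.* (P ℚ.+ K ℚ.* d) ℚ.+ B ℚ.* Y ℚ.* d) ℚ.+ B ℚ.* (M ℚ.- s) ℚ.* (K ℚ.* d)
    ≡⟨ collect A B M Y P K s d ⟩
  (A ℚ.+ B ℚ.* s) ℚ.* P ℚ.+ (B ℚ.* Y ℚ.+ (A ℚ.+ B ℚ.* M) ℚ.* K) ℚ.* d ∎
  where
  open ℚ.≤-Reasoning
  d : ℚ
  d = M ℚ.- s ℚ.* s
  expand : ∀ A B M X Y s →
    (A ℚ.* X ℚ.+ B ℚ.* M ℚ.* Y) ℚ.+ (B ℚ.* X ℚ.+ A ℚ.* Y) ℚ.* s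
    ≡ (A ℚ.+ B ℚ.* s) ℚ.* (X ℚ.+ Y ℚ.* s) ℚ.+ B ℚ.* Y ℚ.* (M ℚ.- s ℚ.* s)
  expand = solve 6 (λ A B M X Y s →
    (A :* X :+ B :* M :* Y) :+ (B :* X :+ A :* Y) :* s
    := (A :+ B :* s) :* (X :+ Y :* s) :+ B :* Y :* (M :- s :* s)) refl
    where open ℚ.+-*-Solver
  collect : ∀ A B M Y P K s d →
    ((A ℚ.+ B ℚ.* s) ℚ.* (P ℚ.+ K ℚ.* d) ℚ.+ B ℚ.* Y ℚ.* d) ℚ.+ B ℚ.* (M ℚ.- s) ℚ.* (K ℚ.* d)
    ≡ (A ℚ.+ B ℚ.* s) ℚ.* P ℚ.+ (B ℚ.* Y ℚ.+ (A ℚ.+ B ℚ.* M) ℚ.* K) ℚ.* d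
  collect = solve 8 (λ A B M Y P K s d →
    ((A :+ B :* s) :* (P :+ K :* d) :+ B :* Y :* d) :+ B :* (M :- s) :* (K :* d)
    := (A :+ B :* s) :* P :+ (B :* Y :+ (A :+ B :* M) :* K) :* d) refl
    where open ℚ.+-*-Solver

-- Both equations hold by computation, but left to the conversion checker inside a larger
-- goal they make it unfold rational arithmetic; rewriting with them keeps the terms folded.
seq-^-suc : ∀ r n k → seq (r ^ℝ suc n) k ≡ seq r k ℚ.* seq (r ^ℝ n) k
seq-^-suc r n k = refl

seq-+* : ∀ p q r k → seq (p +ℝ q *ℝ r) k ≡ seq p k ℚ.+ seq q k ℚ.* seq r k
seq-+* p q r k = refl

-- (a + b√m)ⁿ = X n + Y n √m with natural X n and Y n
module Surd (a b m : ℕ) where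

  X Y : ℕ → ℕ
  X zero    = 1
  X (suc n) = a ℕ.* X n ℕ.+ b ℕ.* m ℕ.* Y n
  Y zero    = 0
  Y (suc n) = b ℕ.* X n ℕ.+ a ℕ.* Y n

  -- Bounds the error of that identity, relative to m − s², when s ≤ √m replaces √m.
  K : ℕ → ℕ
  K zero    = 0
  K (suc n) = b ℕ.* Y n ℕ.+ (a ℕ.+ b ℕ.* m) ℕ.* K n

  -- Iterates `power-step`. As `K n` is the same for all `k`, the error tends to 0 when `s`
  -- approaches √m.
  power-bound : ∀ n k → let s = √-seq m k in
    ι (X n) ℚ.+ ι (Y n) ℚ.* s ℚ.≤
    seq ((fromℕ a +ℝ fromℕ b *ℝ √ m) ^ℝ n) k ℚ.+ ι (K n) ℚ.* (ι m ℚ.- s ℚ.* s)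
  power-bound zero    k = ℚ.≤-reflexive (eq 1ℚ (√-seq m k) (ι m ℚ.- √-seq m k ℚ.* √-seq m k))
    where
    eq : ∀ o s d → o ℚ.+ 0ℚ ℚ.* s ≡ o ℚ.+ 0ℚ ℚ.* d
    eq o s d = cong (o ℚ.+_) (trans (ℚ.*-zeroˡ s) (sym (ℚ.*-zeroˡ d)))
  power-bound (suc n) k = subst₂ ℚ._≤_
    (cong₂ (λ p q → p ℚ.+ q ℚ.* √-seq m k) (sym ιX) (sym ιY))
    (cong₂ (λ p q → p ℚ.+ q ℚ.* (ι m ℚ.- √-seq m k ℚ.* √-seq m k)) (sym P-suc) (sym ιK))
    (power-step {ι a} {ι b} {ι m} {ι (X n)} {ι (Y n)} {P} {ι (K n)} {√-seq m k}
      (0≤ι a) (0≤ι b) (0≤ι (X n)) (0≤ι (Y n)) (0≤ι (K n))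
      (√-nonNegative m k) (√-seq≤ m k) (√-seq² m k) (power-bound n k))
    where
    P : ℚ
    P = seq ((fromℕ a +ℝ fromℕ b *ℝ √ m) ^ℝ n) k
    P-suc : seq ((fromℕ a +ℝ fromℕ b *ℝ √ m) ^ℝ suc n) k ≡ (ι a ℚ.+ ι b ℚ.* √-seq m k) ℚ.* P
    P-suc = trans (seq-^-suc (fromℕ a +ℝ fromℕ b *ℝ √ m) n k)
      (cong (ℚ._* P) (seq-+* (fromℕ a) (fromℕ b) (√ m) k))
    ιX : ι (X (suc n)) ≡ ι a ℚ.* ι (X n) ℚ.+ ι b ℚ.* ι m ℚ.* ι (Y n)
    ιX = trans (ι-+ (a ℕ.* X n) (b ℕ.* m ℕ.* Y n)) (cong₂ ℚ._+_ (ι-* a (X n))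
      (trans (ι-* (b ℕ.* m) (Y n)) (cong (ℚ._* ι (Y n)) (ι-* b m))))
    ιY : ι (Y (suc n)) ≡ ι b ℚ.* ι (X n) ℚ.+ ι a ℚ.* ι (Y n)
    ιY = trans (ι-+ (b ℕ.* X n) (a ℕ.* Y n)) (cong₂ ℚ._+_ (ι-* b (X n)) (ι-* a (Y n)))
    ιK : ι (K (suc n)) ≡ ι b ℚ.* ι (Y n) ℚ.+ (ι a ℚ.+ ι b ℚ.* ι m) ℚ.* ι (K n)
    ιK = trans (ι-+ (b ℕ.* Y n) ((a ℕ.+ b ℕ.* m) ℕ.* K n)) (cong₂ ℚ._+_ (ι-* b (Y n))
      (trans (ι-* (a ℕ.+ b ℕ.* m) (K n)) (cong (ℚ._* ι (K n))
        (trans (ι-+ a (b ℕ.* m)) (cong (ι a ℚ.+_) (ι-* b m))))))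

  power-eventually : ∀ n → ∃ λ N → ∀ k → N ℕ.≤ k →
    ι (X n) ℚ.+ ι (Y n) ℚ.* √-seq m k ℚ.≤ seq ((fromℕ a +ℝ fromℕ b *ℝ √ m) ^ℝ n) k ℚ.+ 1ℚ
  power-eventually n =
    let N , close = √-square m δ 0<δ
    in N , λ k N≤k → ℚ.≤-trans (power-bound n k) (ℚ.+-monoʳ-≤
      (seq ((fromℕ a +ℝ fromℕ b *ℝ √ m) ^ℝ n) k) (error k (close k N≤k)))
    where
    -- `suc (K n)` in place of `K n` keeps the divisor positive, as `K zero` is 0.
    δ,0<δ,eδ : ∃ λ δ → 0ℚ ℚ.< δ × ι (suc (K n)) ℚ.* δ ≡ 1ℚ
    δ,0<δ,eδ = divide (ι (suc (K n)))
      (ℚ.<-≤-trans (ℚ.positive⁻¹ 1ℚ) (ι-mono (ℕ.s≤s (ℕ.z≤n {K n})))) (ℚ.positive⁻¹ 1ℚ)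
    δ : ℚ
    δ = proj₁ δ,0<δ,eδ
    0<δ : 0ℚ ℚ.< δ
    0<δ = proj₁ (proj₂ δ,0<δ,eδ)
    error : ∀ k → ∣ √-seq m k ℚ.* √-seq m k ℚ.- ι m ∣ ℚ.≤ δ →
            ι (K n) ℚ.* (ι m ℚ.- √-seq m k ℚ.* √-seq m k) ℚ.≤ 1ℚ
    error k close = begin
      ι (K n) ℚ.* d       ≤⟨ *-mono-≤₀ (0≤ι (K n)) (ℚ.<⇒≤ 0<δ) (ι-mono (ℕ.n≤1+n (K n))) d≤δ ⟩
      ι (suc (K n)) ℚ.* δ ≡⟨ proj₂ (proj₂ δ,0<δ,eδ) ⟩
      1ℚ                  ∎
      where
      open ℚ.≤-Reasoning
      d = ι m ℚ.- √-seq m k ℚ.* √-seq m k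
      d≤δ : d ℚ.≤ δ
      d≤δ = begin
        d                                     ≡⟨ ℚ.0≤p⇒∣p∣≡p (p≤q⇒0≤q-p (√-seq² m k)) ⟨
        ∣ d ∣                                 ≡⟨ ∣p-q∣≡∣q-p∣ (ι m) (√-seq m k ℚ.* √-seq m k) ⟩
        ∣ √-seq m k ℚ.* √-seq m k ℚ.- ι m ∣   ≤⟨ close ⟩
        δ                                     ∎

-- A numerator `r` below `suc k` would give `(r + 1)² ≤ (k + 1)² ≤ m (k + 1)²`, against the upper
-- bound for the integer square root.
1≤√-seq : ∀ m k .{{_ : NonZero m}} → 1ℚ ℚ.≤ √-seq m k
1≤√-seq m k = ≤-by-cross 1 0 (√-numerator m k) k (begin
  1 ℕ.* suc k              ≡⟨ ℕ.*-identityˡ (suc k) ⟩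
  suc k                    ≤⟨ ℕ.≮⇒≥ (λ r<k → ℕ.<⇒≱ (⌊√⌋-upper (m ℕ.* (suc k ℕ.* suc k)))
    (ℕ.≤-trans (ℕ.*-mono-≤ r<k r<k) (ℕ.m≤n*m (suc k ℕ.* suc k) m))) ⟩
  √-numerator m k          ≡⟨ ℕ.*-identityʳ _ ⟨
  √-numerator m k ℕ.* 1    ∎)
  where open ℕ.≤-Reasoning

-- Comparison of the word count with (7 + 4√3)ⁿ

open Surd 7 4 3

-- Both formulas come from squaring `x n + y n √3`, because (2 + √3)² = 7 + 4√3.
X≡ : ∀ n → X n ≡ x n ℕ.* x n ℕ.+ 3 ℕ.* (y n ℕ.* y n)
Y≡ : ∀ n → Y n ≡ 2 ℕ.* (x n ℕ.* y n)
X≡ zero    = refl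
X≡ (suc n) = trans (cong₂ (λ p q → 7 ℕ.* p ℕ.+ 12 ℕ.* q) (X≡ n) (Y≡ n)) (eq (x n) (y n))
  where
  eq : ∀ a b → 7 ℕ.* (a ℕ.* a ℕ.+ 3 ℕ.* (b ℕ.* b)) ℕ.+ 12 ℕ.* (2 ℕ.* (a ℕ.* b))
       ≡ (2 ℕ.* a ℕ.+ 3 ℕ.* b) ℕ.* (2 ℕ.* a ℕ.+ 3 ℕ.* b)
         ℕ.+ 3 ℕ.* ((a ℕ.+ 2 ℕ.* b) ℕ.* (a ℕ.+ 2 ℕ.* b))
  eq = solve 2 (λ a b → con 7 :* (a :* a :+ con 3 :* (b :* b)) :+ con 12 :* (con 2 :* (a :* b))
    := (con 2 :* a :+ con 3 :* b) :* (con 2 :* a :+ con 3 :* b)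
       :+ con 3 :* ((a :+ con 2 :* b) :* (a :+ con 2 :* b))) refl
    where open +-*-Solver
Y≡ zero    = refl
Y≡ (suc n) = trans (cong₂ (λ p q → 4 ℕ.* p ℕ.+ 7 ℕ.* q) (X≡ n) (Y≡ n)) (eq (x n) (y n))
  where
  eq : ∀ a b → 4 ℕ.* (a ℕ.* a ℕ.+ 3 ℕ.* (b ℕ.* b)) ℕ.+ 7 ℕ.* (2 ℕ.* (a ℕ.* b))
       ≡ 2 ℕ.* ((2 ℕ.* a ℕ.+ 3 ℕ.* b) ℕ.* (a ℕ.+ 2 ℕ.* b))
  eq = solve 2 (λ a b → con 4 :* (a :* a :+ con 3 :* (b :* b)) :+ con 7 :* (con 2 :* (a :* b))
    := con 2 :* ((con 2 :* a :+ con 3 :* b) :* (a :+ con 2 :* b))) refl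
    where open +-*-Solver

-- Putting 1 for √3 in `X n + Y n √3` leaves `(x n + y n)² + 2 (y n)²`, and `y n` is at least 1 for
-- positive `n`.
S+2≤X+Y : ∀ n .{{_ : NonZero n}} → S n [1324] ℕ.+ 2 ℕ.≤ X n ℕ.+ Y n
S+2≤X+Y n = begin
  S n [1324] ℕ.+ 2
    ≤⟨ ℕ.+-mono-≤ (S-bound n) (ℕ.*-monoʳ-≤ 2 (ℕ.*-mono-≤ (0<y n) (0<y n))) ⟩
  (x n ℕ.+ y n) ℕ.* (x n ℕ.+ y n) ℕ.+ 2 ℕ.* (y n ℕ.* y n)
    ≡⟨ eq (x n) (y n) ⟩
  (x n ℕ.* x n ℕ.+ 3 ℕ.* (y n ℕ.* y n)) ℕ.+ 2 ℕ.* (x n ℕ.* y n)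
    ≡⟨ cong₂ ℕ._+_ (X≡ n) (Y≡ n) ⟨
  X n ℕ.+ Y n ∎
  where
  open ℕ.≤-Reasoning
  eq : ∀ a b → (a ℕ.+ b) ℕ.* (a ℕ.+ b) ℕ.+ 2 ℕ.* (b ℕ.* b)
               ≡ (a ℕ.* a ℕ.+ 3 ℕ.* (b ℕ.* b)) ℕ.+ 2 ℕ.* (a ℕ.* b)
  eq = solve 2 (λ a b → (a :+ b) :* (a :+ b) :+ con 2 :* (b :* b)
    := (a :* a :+ con 3 :* (b :* b)) :+ con 2 :* (a :* b)) refl
    where open +-*-Solver

mainTheorem1 : (n : ℕ) → .{{_ : NonZero n}} →
    fromℕ (S n [1324]) <ℝ (fromℕ 7 +ℝ fromℕ 4 *ℝ √ 3) ^ℝ n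
mainTheorem1 n = 1ℚ , ℚ.positive⁻¹ 1ℚ , N , λ k N≤k → cancel (begin
  -- Of the surplus 2 from `S+2≤X+Y`, one unit is the uniform gap and the other pays for the error
  -- in `power-eventually`.
  (ι (S n [1324]) ℚ.+ 1ℚ) ℚ.+ 1ℚ     ≡⟨ ℚ.+-assoc (ι (S n [1324])) 1ℚ 1ℚ ⟩
  ι (S n [1324]) ℚ.+ ι 2             ≡⟨ ι-+ (S n [1324]) 2 ⟨
  ι (S n [1324] ℕ.+ 2)               ≤⟨ ι-mono (S+2≤X+Y n) ⟩
  ι (X n ℕ.+ Y n)                    ≡⟨ ι-+ (X n) (Y n) ⟩
  ι (X n) ℚ.+ ι (Y n)                ≡⟨ cong (ι (X n) ℚ.+_) (ℚ.*-identityʳ (ι (Y n))) ⟨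
  ι (X n) ℚ.+ ι (Y n) ℚ.* 1ℚ
    ≤⟨ ℚ.+-monoʳ-≤ (ι (X n)) (*-mono-≤₀ (0≤ι (Y n)) (√-nonNegative 3 k) (ℚ.≤-refl {ι (Y n)})
         (1≤√-seq 3 k)) ⟩
  ι (X n) ℚ.+ ι (Y n) ℚ.* √-seq 3 k  ≤⟨ bound k N≤k ⟩
  seq ((fromℕ 7 +ℝ fromℕ 4 *ℝ √ 3) ^ℝ n) k ℚ.+ 1ℚ ∎)
  where
  open ℚ.≤-Reasoning
  N = proj₁ (power-eventually n)
  bound = proj₂ (power-eventually n)
  cancel : ∀ {p q} → p ℚ.+ 1ℚ ℚ.≤ q ℚ.+ 1ℚ → p ℚ.≤ q
  cancel {p} {q} h = subst₂ ℚ._≤_ (eq p 1ℚ) (eq q 1ℚ) (ℚ.+-monoˡ-≤ (ℚ.- 1ℚ) h)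
    where
    eq : ∀ p o → (p ℚ.+ o) ℚ.- o ≡ p
    eq = solve 2 (λ p o → (p :+ o) :- o := p) refl where open ℚ.+-*-Solver
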